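{- Let $G$ be a finite simple graph that is $\{\text{Chair}, P_4+K_1\}$-free. Then $\chi(G)\le 2\omega(G)-1$.
   Context: $\chi(G)$ is the chromatic number and $\omega(G)$ the clique number. The Chair (fork) is the graph on vertices $c,a,b,d,e$ with edges $ca,cb,cd,de$. $P_4+K_1$ denotes the join of the path $P_4$ with a single vertex (the gem): a path $p_1p_2p_3p_4$ plus a vertex adjacent to all of $p_1,\dots,p_4$. A graph is $\{H_1,\dots,H_k\}$-free if it has no induced subgraph isomorphic to any $H_i$. -}

module Defs where

open import Data.Nat using (ℕ; zero; suc; _*_; _∸_)
open import Data.Fin using (Fin; zero; suc)
open import Data.Bool using (Bool; true; false)
open import Data.Product using (Σ; _×_; ∃-syntax)
open import Relation.Binary.PropositionalEquality using (_≡_; _≢_)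
open import Relation.Nullary using (¬_)
open import Function.Definitions using (Injective)

record Graph (n : ℕ) : Set where
  field
    adj   : Fin n → Fin n → Bool
    sym   : ∀ u v → adj u v ≡ adj v u
    irrefl : ∀ v → adj v v ≡ false
open Graph public

_InducedIn_ : ∀ {k n} → (Fin k → Fin k → Bool) → Graph n → Set
_InducedIn_ {k} {n} H G =
  Σ (Fin k → Fin n) λ f → Injective _≡_ _≡_ f ×
    (∀ i j → i ≢ j → adj G (f i) (f j) ≡ H i j)

_Free_ : ∀ {k n} → Graph n → (Fin k → Fin k → Bool) → Set
G Free H = ¬ (H InducedIn G)

-- Chair (fork): vertices c,a,b,d,e = 0,1,2,3,4 ; edges ca, cb, cd, de.
chair : Fin 5 → Fin 5 → Bool
chair zero (suc zero) = true
chair zero (suc (suc zero)) = true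
chair zero (suc (suc (suc zero))) = true
chair (suc zero) zero = true
chair (suc (suc zero)) zero = true
chair (suc (suc (suc zero))) zero = true
chair (suc (suc (suc zero))) (suc (suc (suc (suc zero)))) = true
chair (suc (suc (suc (suc zero)))) (suc (suc (suc zero))) = true
chair _ _ = false

-- Gem P4+K1: p1,p2,p3,p4,v = 0,1,2,3,4 ; edges p1p2,p2p3,p3p4, v adjacent to all p_i.
gem : Fin 5 → Fin 5 → Bool
gem zero (suc zero) = true
gem (suc zero) zero = true
gem (suc zero) (suc (suc zero)) = true
gem (suc (suc zero)) (suc zero) = true
gem (suc (suc zero)) (suc (suc (suc zero))) = true
gem (suc (suc (suc zero))) (suc (suc zero)) = true
gem (suc (suc (suc (suc zero)))) (suc (suc (suc (suc zero)))) = false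
gem (suc (suc (suc (suc zero)))) _ = true
gem _ (suc (suc (suc (suc zero)))) = true
gem _ _ = false

HasClique : ∀ {n} → Graph n → ℕ → Set
HasClique {n} G k =
  Σ (Fin k → Fin n) λ f → Injective _≡_ _≡_ f ×
    (∀ i j → i ≢ j → adj G (f i) (f j) ≡ true)

IsCliqueNumber : ∀ {n} → Graph n → ℕ → Set
IsCliqueNumber G ω = HasClique G ω × (∀ k → HasClique G k → k Data.Nat.≤ ω)

ProperColouring : ∀ {n} → Graph n → ℕ → Set
ProperColouring {n} G k =
  Σ (Fin n → Fin k) λ c → ∀ u v → adj G u v ≡ true → c u ≢ c v

χ≤ : ∀ {n} → Graph n → ℕ → Set
χ≤ G k = ProperColouring G k

{-# OPTIONS --safe #-}
module Submission where

-- Take a minimal counterexample G. A vertex v is the centre of a claw: otherwise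
-- its neighbourhood, being P₄-free, is a cograph without stable triples and has
-- at most 2(ω − 1) vertices, so that a colouring of G − v extends. A module of G
-- is a clique: it is a cograph, and a cograph retracts onto one of its cliques,
-- so that G would map to a proper subgraph. Hence the quotient of G by true
-- twins is prime and has only claw centres. A finite case analysis excludes the
-- bull, C₅ and the house from such a quotient, primality then excludes the paw
-- and the triangle, and a triangle-free quotient is bipartite. Finally a
-- bipartite graph with vertices blown up to cliques has an ω-colouring.

open import Defs hiding (sym)
open import Axiom.UniquenessOfIdentityProofs using (module Decidable⇒UIP)
open import Data.Bool using (Bool; true; false; not; _∧_; _∨_; if_then_else_)
open import Data.Bool.ListAction using (all; any)
import Data.Bool.Properties as Bool
open import Data.Empty using (⊥; ⊥-elim)
open import Data.Fin using (Fin; zero; suc; toℕ; punchIn; punchOut; opposite)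
import Data.Fin as Fin
open import Data.Fin.Properties as Fin using (any?; all?; injective⇒≤; punchIn-injective; punchIn-punchOut)
open import Data.List.Base as List using (List; []; _∷_; _++_; map; concatMap; filter; upTo; allFin; length)
import Data.List.Membership.DecPropositional as DecMembership
open import Data.List.Membership.Propositional using (_∈_; _∉_; lose; find)
open import Data.List.Membership.Propositional.Properties
  using (∈-filter⁺; ∈-filter⁻; ∈-upTo⁺; ∈-upTo⁻; ∈-concatMap⁺; ∈-++⁺ˡ; ∈-++⁺ʳ; ∈-++⁻; ∈-map⁺;
         ∈-allFin; ∈-lookup; ∈-length)
open import Data.List.Properties using (≡-dec; length-map; length-tabulate; length-++; map-∘)
open import Data.List.Relation.Binary.Pointwise using (Pointwise; []; _∷_)
open import Data.List.Relation.Unary.All as All using (All; []; _∷_; lookup; tabulate)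
open import Data.List.Relation.Unary.All.Properties using (All¬⇒¬Any; ¬Any⇒All¬; ¬All⇒Any¬)
open import Data.List.Relation.Unary.AllPairs using (AllPairs; []; _∷_)
open import Data.List.Relation.Unary.Any as Any using (here; there; index)
open import Data.List.Relation.Unary.Any.Properties using (lookup-index)
open import Data.List.Relation.Unary.Unique.Propositional using (Unique)
open import Data.List.Relation.Unary.Unique.Propositional.Properties using (allFin⁺; upTo⁺)
  renaming (filter⁺ to Unique-filter⁺; ++⁺ to Unique-++⁺; map⁺ to Unique-map⁺)
open import Data.Nat using (ℕ; zero; suc; _+_; _*_; _∸_; _≟_; _≤_; _<_; _<?_; z≤n; s≤s; s≤s⁻¹; z<s; s<s)
import Data.Nat.Properties as ℕ
open import Data.Product using (Σ; _×_; _,_; ∃; proj₁; proj₂)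
open import Data.Sum using (_⊎_; inj₁; inj₂; [_,_]′)
import Data.Vec.Functional as Vector
open import Function using (_∘_; case_of_; id; mk⇔)
open import Relation.Binary.Definitions using (DecidableEquality; tri<; tri≈; tri>)
open import Relation.Binary.PropositionalEquality
  using (_≡_; _≢_; _≗_; refl; sym; trans; cong; cong₂; subst)
open import Relation.Nullary using (Dec; yes; no; does; ¬_; ¬?; contradiction)
open import Relation.Nullary.Decidable
  using (True; toWitness; from-yes; map′; _×-dec_; _⊎-dec_; _→-dec_; dec-true; dec-false; decidable-stable; does-⇔)

-- The bound 2ω - 1 is spent at a vertex that is no claw centre: at most 2(ω - 1) neighbours leave
-- one colour free. The obstacle in the case analysis is that a copy of a small pattern sits in a
-- graph of unknown size. A claw at a chosen vertex of the copy involves only three further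
-- vertices, and a vertex outside the copy is described by its row of adjacencies to the copy, one
-- of finitely many. Several vertices may share a row; primality limits this, because vertices of
-- one row that nothing else can tell apart form a module, so there is at most one. What is left is
-- a finite search for three pairwise non-adjacent neighbours, decided by computation. If it fails,
-- the pattern cannot occur and may be forbidden in later searches; `fan⁻` and `prism⁻` are stepping
-- stones to the bull and the house.

does⇒ : ∀ {P : Set} (P? : Dec P) → does P? ≡ true → P
does⇒ (yes p) _ = p

not⇒false : ∀ {b} → not b ≡ true → b ≡ false
not⇒false {false} _ = refl

both : ∀ {a b} → a ∧ b ≡ true → a ≡ true × b ≡ true
both {true} {true} _ = refl , refl

conj : ∀ {a b} → a ≡ true → b ≡ true → a ∧ b ≡ true
conj refl refl = refl

right : ∀ {a b} → a ≡ false → a ∨ b ≡ true → b ≡ true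
right refl q = q

all⇒ : ∀ {A : Set} (p : A → Bool) {xs x} → all p xs ≡ true → x ∈ xs → p x ≡ true
all⇒ p q (here refl) = proj₁ (both q)
all⇒ p {y ∷ _} q (there x∈) = all⇒ p (proj₂ (both {p y} q)) x∈

all⇐ : ∀ {A : Set} (p : A → Bool) xs → (∀ {x} → x ∈ xs → p x ≡ true) → all p xs ≡ true
all⇐ p [] _ = refl
all⇐ p (x ∷ xs) h rewrite h (here refl) = all⇐ p xs (h ∘ there)

any⇒ : ∀ {A : Set} (p : A → Bool) xs → any p xs ≡ true → ∃ λ x → x ∈ xs × p x ≡ true
any⇒ p (x ∷ xs) q with p x in eq
... | true = x , here refl , eq
... | false with any⇒ p xs q
...   | y , y∈ , py = y , there y∈ , py

-- Computable search for claws around a small pattern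

-- A graph on an ordered list of vertices, newest first: each vertex is
-- represented by its adjacencies to the older ones.
Row Rows : Set
Row = List Bool
Rows = List Row

_≟ᵣ_ : DecidableEquality Row
_≟ᵣ_ = ≡-dec Bool._≟_

-- Out of range indices give false.
at : Row → ℕ → Bool
at [] _ = false
at (b ∷ r) zero = b
at (b ∷ r) (suc j) = at r j

entry : Rows → ℕ → ℕ → Bool
entry [] _ _ = false
entry (r ∷ S) zero zero = false
entry (r ∷ S) zero (suc j) = at r j
entry (r ∷ S) (suc i) zero = at r i
entry (r ∷ S) (suc i) (suc j) = entry S i j

pick : Rows → List ℕ → Rows
pick S [] = []
pick S (i ∷ is) = map (entry S i) is ∷ pick S is

fits : Rows → ℕ → List ℕ → Row → Bool
fits S i [] [] = true
fits S i (j ∷ is) (b ∷ r) = does (entry S i j Bool.≟ b) ∧ not (does (i ≟ j)) ∧ fits S i is r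
fits S i _ _ = false

-- Backtracking from the oldest vertex of the pattern on: the continuation `k` receives the indices
-- chosen so far and places the newer vertices.
has : Rows → Rows → List ℕ → (List ℕ → Bool) → Bool
has S [] js k = k []
has S (r ∷ P) js k = has S P js (λ is → any (λ i → fits S i is r ∧ k (i ∷ is)) js)

free : List Rows → Rows → Bool
free Φ S = all (λ P → not (has S P (upTo (length S)) (λ _ → true))) Φ

bits : ℕ → List Row
bits zero = [] ∷ []
bits (suc n) = concatMap (λ r → (true ∷ r) ∷ (false ∷ r) ∷ []) (bits n)

types : List Rows → Rows → List Row
types Φ S = filter (λ r → free Φ (r ∷ S) Bool.≟ true) (bits (length S))

-- No vertex of another type separates two vertices of type t over R, so the
-- vertices of type t form a module: in a prime graph there is at most one.
lonely : List Rows → Rows → Row → Bool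
lonely Φ [] t = false
lonely Φ R@(_ ∷ _) t = all (λ u → does (u ≟ᵣ t) ∨ (clash u true ∧ clash u false)) (types Φ R)
  where
  clash : Row → Bool → Bool
  clash u b = not (free Φ ((true ∷ false ∷ u) ∷ (b ∷ t) ∷ t ∷ R))

others : Rows → ℕ → List ℕ
others S h = filter (λ i → ¬? (i ≟ h)) (upTo (length S))

others-∈ : ∀ S h {i} → i ∈ others S h → i ∈ upTo (length S) × i ≢ h
others-∈ S h = ∈-filter⁻ (λ i → ¬? (i ≟ h))

others-Unique : ∀ S h → Unique (others S h)
others-Unique S h = Unique-filter⁺ (λ i → ¬? (i ≟ h)) (upTo⁺ (length S))

-- A vertex of type r would be a second vertex of the type of h over the rest of S.
clone : List Rows → Rows → Row → ℕ → Bool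
clone Φ S r h =
  does (map (at r) (others S h) ≟ᵣ map (entry S h) (others S h))
  ∧ lonely Φ (pick S (others S h)) (map (entry S h) (others S h))

-- A neighbour of `v` either lies in the pattern or is known only through its row over it.
data Kind : Set where
  old : ℕ → Kind
  new : Row → Kind

kinds : List Rows → Rows → ℕ → List Kind
kinds Φ S v =
  map old (filter (λ i → entry S v i Bool.≟ true) (upTo (length S))) ++
  map new (filter (λ r → (at r v ∧ all (λ h → not (clone Φ S r h)) (upTo (length S))) Bool.≟ true)
                  (types Φ S))

-- Errs towards `true`: it has to hold whenever distinct vertices of these kinds can be
-- non-adjacent.
apart : List Rows → Rows → Kind → Kind → Bool
apart Φ S (old i) (old j) = not (does (i ≟ j)) ∧ not (entry S i j)
apart Φ S (old i) (new r) = not (at r i)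
apart Φ S (new r) (old i) = not (at r i)
apart Φ S (new r) (new q) =
  not (does (r ≟ᵣ q) ∧ lonely Φ S r) ∧ free Φ ((false ∷ r) ∷ q ∷ S)

clawless : List Rows → Rows → ℕ → Bool
clawless Φ S v = all starless (kinds Φ S v)
  where
  starless : Kind → Bool
  starless a = complete (filter (λ b → apart Φ S a b Bool.≟ true) (kinds Φ S v))
    where
    complete : List Kind → Bool
    -- Equal `b` and `c` are included, since two leaves of a claw may have the same row.
    complete bs = all (λ b → all (λ c → not (apart Φ S b c)) bs) bs

-- Soundness of indices and of the pattern search

data At {V : Set} : List V → ℕ → V → Set where
  here : ∀ {x xs} → At (x ∷ xs) zero x
  there : ∀ {x y xs i} → At xs i x → At (y ∷ xs) (suc i) x

module _ {V : Set} where

  At⇒∈ : ∀ {xs : List V} {i x} → At xs i x → x ∈ xs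
  At⇒∈ here = here refl
  At⇒∈ (there p) = there (At⇒∈ p)

  ∈⇒At : ∀ {xs : List V} {x} → x ∈ xs → ∃ λ i → At xs i x
  ∈⇒At (here refl) = _ , here
  ∈⇒At (there p) = _ , there (proj₂ (∈⇒At p))

  At⇒< : ∀ {xs : List V} {i x} → At xs i x → i < length xs
  At⇒< here = z<s
  At⇒< (there p) = s<s (At⇒< p)

  <⇒At : ∀ {xs : List V} {i} → i < length xs → ∃ λ x → At xs i x
  <⇒At {_ ∷ _} {zero} _ = _ , here
  <⇒At {_ ∷ _} {suc i} (s<s p) = _ , there (proj₂ (<⇒At p))

  At-injective : ∀ {xs : List V} {i j x} → Unique xs → At xs i x → At xs j x → i ≡ j
  At-injective _ here here = refl
  At-injective (x∉ ∷ _) here (there q) = contradiction (At⇒∈ q) (All¬⇒¬Any x∉)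
  At-injective (x∉ ∷ _) (there p) here = contradiction (At⇒∈ p) (All¬⇒¬Any x∉)
  At-injective (_ ∷ u) (there p) (there q) = cong suc (At-injective u p q)

  At-functional : ∀ {xs : List V} {i x y} → At xs i x → At xs i y → x ≡ y
  At-functional here here = refl
  At-functional (there p) (there q) = At-functional p q

  at-map : ∀ (f : V → Bool) {xs j y} → At xs j y → at (map f xs) j ≡ f y
  at-map f here = refl
  at-map f (there q) = at-map f q

  map≡⇒ : ∀ {f g : V → Bool} {xs x} → map f xs ≡ map g xs → x ∈ xs → f x ≡ g x
  map≡⇒ {f} {g} {_ ∷ _} {x} eq x∈ with ∈⇒At x∈
  ... | i , p = trans (sym (at-map f p)) (trans (cong (λ r → at r i) eq) (at-map g p))

  Atₛ : List V → List ℕ → List V → Set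
  Atₛ xs = Pointwise (At xs)

  <⇒Atₛ : ∀ {xs : List V} is → (∀ {i} → i ∈ is → i < length xs) → ∃ λ ys → Atₛ xs is ys
  <⇒Atₛ [] _ = [] , []
  <⇒Atₛ (i ∷ is) h = _ , proj₂ (<⇒At (h (here refl))) ∷ proj₂ (<⇒Atₛ is (h ∘ there))

  Atₛ-∈ : ∀ {xs : List V} {is ys y} → Atₛ xs is ys → y ∈ ys → ∃ λ i → i ∈ is × At xs i y
  Atₛ-∈ (p ∷ _) (here refl) = _ , here refl , p
  Atₛ-∈ (_ ∷ ps) (there y∈) with Atₛ-∈ ps y∈
  ... | i , i∈ , q = i , there i∈ , q

  Atₛ-Unique : ∀ {xs : List V} {is ys} → Unique xs → Unique is → Atₛ xs is ys → Unique ys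
  Atₛ-Unique _ _ [] = []
  Atₛ-Unique u (i∉ ∷ v) (p ∷ ps) = tabulate new∉ ∷ Atₛ-Unique u v ps
    where
    new∉ : ∀ {y} → y ∈ _ → _ ≢ y
    new∉ y∈ refl with Atₛ-∈ ps y∈
    ... | j , j∈ , q = lookup i∉ j∈ (At-injective u p q)

  at-maps : ∀ (f : V → Bool) {xs is ys} → Atₛ xs is ys → map (at (map f xs)) is ≡ map f ys
  at-maps f [] = refl
  at-maps f (p ∷ ps) = cong₂ _∷_ (at-map f p) (at-maps f ps)

fits⇒ : ∀ S i is r → fits S i is r ≡ true → map (entry S i) is ≡ r × All (i ≢_) is
fits⇒ S i [] [] _ = refl , []
fits⇒ S i (j ∷ is) (b ∷ r) q with both {does (entry S i j Bool.≟ b)} q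
... | e , q′ with both {not (does (i ≟ j))} q′
...   | n , q″ with fits⇒ S i is r q″
...     | eqs , fresh =
  cong₂ _∷_ (does⇒ (entry S i j Bool.≟ b) e) eqs ,
  (λ i≡j → case trans (sym n) (cong not (dec-true (i ≟ j) i≡j)) of λ ()) ∷ fresh

has⇒ : ∀ S P js k → has S P js k ≡ true →
  ∃ λ is → (∀ {i} → i ∈ is → i ∈ js) × Unique is × pick S is ≡ P × k is ≡ true
has⇒ S [] js k q = [] , (λ ()) , [] , refl , q
has⇒ S (r ∷ P) js k q with has⇒ S P js _ q
... | is , is⊆ , u , refl , q′ with any⇒ (λ i → fits S i is r ∧ k (i ∷ is)) js q′
...   | i , i∈ , q″ with both {fits S i is r} q″
...     | f , k-true with fits⇒ S i is r f
...       | refl , fresh =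
  i ∷ is , (λ { (here refl) → i∈ ; (there j∈) → is⊆ j∈ }) , fresh ∷ u , refl , k-true

bits-complete : ∀ r → r ∈ bits (length r)
bits-complete [] = here refl
bits-complete (true ∷ r) = ∈-concatMap⁺ _ (lose (bits-complete r) (here refl))
bits-complete (false ∷ r) = ∈-concatMap⁺ _ (lose (bits-complete r) (there (here refl)))

-- Vertices are numbered from the last row up. C₅ is the cycle 0-1-3-4-2, the
-- bull is the triangle 2,3,4 with 3-0 and 4-1, the house the bull with 0-1,
-- fan⁻ is the path 1-3-0-4-2 with 5 joined to all but its middle, prism⁻ is two
-- triangles 0,2,3 and 1,4,5 with 2-4 and 3-5.
chairʳ : Rows
chairʳ =
  (true ∷ false ∷ false ∷ false ∷ [])
  ∷ (false ∷ false ∷ true ∷ [])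
  ∷ (false ∷ true ∷ [])
  ∷ (true ∷ [])
  ∷ [] ∷ []

gemʳ : Rows
gemʳ =
  (true ∷ true ∷ true ∷ true ∷ [])
  ∷ (true ∷ false ∷ false ∷ [])
  ∷ (true ∷ false ∷ [])
  ∷ (true ∷ [])
  ∷ [] ∷ []

fan⁻ : Rows
fan⁻ =
  (true ∷ true ∷ true ∷ true ∷ false ∷ [])
  ∷ (false ∷ true ∷ false ∷ true ∷ [])
  ∷ (false ∷ true ∷ true ∷ [])
  ∷ (false ∷ false ∷ [])
  ∷ (false ∷ [])
  ∷ [] ∷ []

bull : Rows
bull =
  (true ∷ true ∷ true ∷ false ∷ [])
  ∷ (true ∷ false ∷ true ∷ [])
  ∷ (false ∷ false ∷ [])
  ∷ (false ∷ [])
  ∷ [] ∷ []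

C₅ : Rows
C₅ =
  (true ∷ true ∷ false ∷ false ∷ [])
  ∷ (false ∷ true ∷ false ∷ [])
  ∷ (false ∷ true ∷ [])
  ∷ (true ∷ [])
  ∷ [] ∷ []

prism⁻ : Rows
prism⁻ =
  (true ∷ true ∷ false ∷ true ∷ false ∷ [])
  ∷ (false ∷ true ∷ true ∷ false ∷ [])
  ∷ (true ∷ false ∷ true ∷ [])
  ∷ (false ∷ true ∷ [])
  ∷ (false ∷ [])
  ∷ [] ∷ []

house : Rows
house =
  (true ∷ true ∷ true ∷ false ∷ [])
  ∷ (true ∷ false ∷ true ∷ [])
  ∷ (false ∷ false ∷ [])
  ∷ (true ∷ [])
  ∷ [] ∷ []

-- Indices count from the newest vertex: 0 is the hub 5 of `fan⁻`, while the last index used in each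
-- of the next four denotes vertex 0. Besides chair and gem, each list forbids only patterns
-- excluded by an earlier certificate, which fixes the order.
fan⁻-clawless : clawless (chairʳ ∷ gemʳ ∷ []) fan⁻ 0 ≡ true
fan⁻-clawless = refl

bull-clawless : clawless (fan⁻ ∷ chairʳ ∷ gemʳ ∷ []) bull 4 ≡ true
bull-clawless = refl

C₅-clawless : clawless (bull ∷ chairʳ ∷ gemʳ ∷ []) C₅ 4 ≡ true
C₅-clawless = refl

prism⁻-clawless : clawless (bull ∷ chairʳ ∷ gemʳ ∷ []) prism⁻ 5 ≡ true
prism⁻-clawless = refl

house-clawless : clawless (prism⁻ ∷ bull ∷ chairʳ ∷ gemʳ ∷ []) house 4 ≡ true
house-clawless = refl

-- Patterns inside an arbitrary graph

module Listing {V : Set} (E : V → V → Bool)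
  (E-sym : ∀ x y → E x y ≡ E y x) (E-irrefl : ∀ x → E x x ≡ false) where

  rows : List V → Rows
  rows [] = []
  rows (x ∷ xs) = map (E x) xs ∷ rows xs

  Avoids : Rows → Set
  Avoids S = ∀ xs → Unique xs → rows xs ≢ S

  length-rows : ∀ xs → length (rows xs) ≡ length xs
  length-rows [] = refl
  length-rows (x ∷ xs) = cong suc (length-rows xs)

  entry-rows : ∀ {xs i j x y} → At xs i x → At xs j y → entry (rows xs) i j ≡ E x y
  entry-rows here here = sym (E-irrefl _)
  entry-rows here (there q) = at-map (E _) q
  entry-rows {y = y} (there {x} p) here = trans (at-map (E y) p) (E-sym y x)
  entry-rows (there p) (there q) = entry-rows p q

  entries-rows : ∀ {xs i x is ys} → At xs i x → Atₛ xs is ys →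
    map (entry (rows xs) i) is ≡ map (E x) ys
  entries-rows p [] = refl
  entries-rows p (q ∷ qs) = cong₂ _∷_ (entry-rows p q) (entries-rows p qs)

  pick-rows : ∀ {xs is ys} → Atₛ xs is ys → pick (rows xs) is ≡ rows ys
  pick-rows [] = refl
  pick-rows (p ∷ ps) = cong₂ _∷_ (entries-rows p ps) (pick-rows ps)

  upTo⇒< : ∀ xs {i} → i ∈ upTo (length (rows xs)) → i < length xs
  upTo⇒< xs i∈ = subst (_ <_) (length-rows xs) (∈-upTo⁻ i∈)

  At⇒upTo : ∀ {xs i x} → At xs i x → i ∈ upTo (length (rows xs))
  At⇒upTo {xs} p = ∈-upTo⁺ (subst (_ <_) (sym (length-rows xs)) (At⇒< p))

  _~_ _≁_ : V → V → Set
  x ~ y = E x y ≡ true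
  x ≁ y = E x y ≡ false

  ~-sym : ∀ {x y} → x ~ y → y ~ x
  ~-sym = trans (E-sym _ _)

  ≁-sym : ∀ {x y} → x ≁ y → y ≁ x
  ≁-sym = trans (E-sym _ _)

  excl : ∀ {x y} → x ~ y → x ≁ y → ⊥
  excl p q = case trans (sym p) q of λ ()

  ~⇒≢ : ∀ {x y} → x ~ y → x ≢ y
  ~⇒≢ p refl = excl p (E-irrefl _)

  -- A third vertex that tells `x` and `y` apart proves them distinct, so most patterns need no list
  -- of inequalities.
  sep : ∀ {x y z} → x ~ z → y ≁ z → x ≢ y
  sep p q refl = excl p q

  pes : ∀ {x y z} → x ≁ z → y ~ z → x ≢ y
  pes p q refl = excl q p

  ~? : ∀ x y → x ~ y ⊎ x ≁ y
  ~? x y with E x y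
  ... | true = inj₁ refl
  ... | false = inj₂ refl

  ¬~⇒≁ : ∀ {x y} → ¬ (x ~ y) → x ≁ y
  ¬~⇒≁ {x} {y} n with ~? x y
  ... | inj₁ p = contradiction p n
  ... | inj₂ p = p

  gem-⊥ : Avoids gemʳ → ∀ {p q r s z} → q ~ p →
    r ≁ p → r ~ q →
    s ≁ p → s ≁ q → s ~ r →
    z ~ p → z ~ q → z ~ r → z ~ s → ⊥
  gem-⊥ no-gem {p} {q} {r} {s} {z} qp rp rq sp sq sr zp zq zr zs =
    no-gem (z ∷ s ∷ r ∷ q ∷ p ∷ []) distinct rows≡
    where
    rows≡ : rows (z ∷ s ∷ r ∷ q ∷ p ∷ []) ≡ gemʳ
    rows≡ rewrite qp | rp | rq | sp | sq | sr | zp | zq | zr | zs = refl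

    distinct : Unique (z ∷ s ∷ r ∷ q ∷ p ∷ [])
    distinct =
      (~⇒≢ zs ∷ ~⇒≢ zr ∷ ~⇒≢ zq ∷ ~⇒≢ zp ∷ [])
      ∷ (~⇒≢ sr ∷ pes sp qp ∷ pes sq (~-sym qp) ∷ [])
      ∷ (~⇒≢ rq ∷ sep (~-sym sr) (≁-sym sp) ∷ [])
      ∷ (~⇒≢ qp ∷ [])
      ∷ [] ∷ []

  bull-⊥ : Avoids bull → ∀ {u w b a z} → w ≁ u →
    b ≁ u → b ≁ w →
    a ~ u → a ≁ w → a ~ b →
    z ≁ u → z ~ w → z ~ b → z ~ a → ⊥
  bull-⊥ no-bull {u} {w} {b} {a} {z} wu bu bw au aw ab zu zw zb za =
    no-bull (z ∷ a ∷ b ∷ w ∷ u ∷ []) distinct rows≡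
    where
    rows≡ : rows (z ∷ a ∷ b ∷ w ∷ u ∷ []) ≡ bull
    rows≡ rewrite wu | bu | bw | au | aw | ab | zu | zw | zb | za = refl

    distinct : Unique (z ∷ a ∷ b ∷ w ∷ u ∷ [])
    distinct =
      (~⇒≢ za ∷ ~⇒≢ zb ∷ ~⇒≢ zw ∷ sep zw (≁-sym wu) ∷ [])
      ∷ (~⇒≢ ab ∷ sep au wu ∷ ~⇒≢ au ∷ [])
      ∷ (sep (~-sym ab) (≁-sym aw) ∷ sep (~-sym zb) (≁-sym zu) ∷ [])
      ∷ (pes (≁-sym aw) (~-sym au) ∷ [])
      ∷ [] ∷ []

  house-⊥ : Avoids house → ∀ {u w b a z} → w ~ u →
    b ≁ u → b ≁ w →
    a ~ u → a ≁ w → a ~ b →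
    z ≁ u → z ~ w → z ~ b → z ~ a → ⊥
  house-⊥ no-house {u} {w} {b} {a} {z} wu bu bw au aw ab zu zw zb za =
    no-house (z ∷ a ∷ b ∷ w ∷ u ∷ []) distinct rows≡
    where
    rows≡ : rows (z ∷ a ∷ b ∷ w ∷ u ∷ []) ≡ house
    rows≡ rewrite wu | bu | bw | au | aw | ab | zu | zw | zb | za = refl

    distinct : Unique (z ∷ a ∷ b ∷ w ∷ u ∷ [])
    distinct =
      (~⇒≢ za ∷ ~⇒≢ zb ∷ ~⇒≢ zw ∷ sep zb (≁-sym bu) ∷ [])
      ∷ (~⇒≢ ab ∷ sep ab (≁-sym bw) ∷ ~⇒≢ au ∷ [])
      ∷ (pes bu wu ∷ pes bw (~-sym wu) ∷ [])
      ∷ (~⇒≢ wu ∷ [])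
      ∷ [] ∷ []

  -- The leaves `a` and `b` have the same neighbours in the chair; adjacency cannot separate them,
  -- hence the hypothesis `b ≢ a`.
  chair-⊥ : Avoids chairʳ → ∀ {c a b d e} → a ~ c →
    b ~ c → b ≁ a →
    d ~ c → d ≁ a → d ≁ b →
    e ≁ c → e ≁ a → e ≁ b → e ~ d → b ≢ a → ⊥
  chair-⊥ no-chair {c} {a} {b} {d} {e} ac bc ba dc da db ec ea eb ed b≢a =
    no-chair (e ∷ d ∷ b ∷ a ∷ c ∷ []) distinct rows≡
    where
    rows≡ : rows (e ∷ d ∷ b ∷ a ∷ c ∷ []) ≡ chairʳ
    rows≡ rewrite ac | bc | ba | dc | da | db | ec | ea | eb | ed = refl

    distinct : Unique (e ∷ d ∷ b ∷ a ∷ c ∷ [])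
    distinct =
      (~⇒≢ ed ∷ pes ec bc ∷ pes ec ac ∷ pes ea (~-sym ac) ∷ [])
      ∷ (sep (~-sym ed) (≁-sym eb) ∷ sep (~-sym ed) (≁-sym ea) ∷ ~⇒≢ dc ∷ [])
      ∷ (b≢a ∷ ~⇒≢ bc ∷ [])
      ∷ (~⇒≢ ac ∷ [])
      ∷ [] ∷ []

  C₅-⊥ : Avoids C₅ → ∀ {v t s x y} → t ~ v →
    s ~ v → s ≁ t →
    x ≁ v → x ~ t → x ≁ s →
    y ≁ v → y ≁ t → y ~ s → y ~ x → ⊥
  C₅-⊥ no-C₅ {v} {t} {s} {x} {y} tv sv st xv xt xs yv yt ys yx =
    no-C₅ (y ∷ x ∷ s ∷ t ∷ v ∷ []) distinct rows≡
    where
    rows≡ : rows (y ∷ x ∷ s ∷ t ∷ v ∷ []) ≡ C₅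
    rows≡ rewrite tv | sv | st | xv | xt | xs | yv | yt | ys | yx = refl

    distinct : Unique (y ∷ x ∷ s ∷ t ∷ v ∷ [])
    distinct =
      (~⇒≢ yx ∷ ~⇒≢ ys ∷ pes yv tv ∷ pes yt (~-sym tv) ∷ [])
      ∷ (pes xv sv ∷ ~⇒≢ xt ∷ pes xs (~-sym sv) ∷ [])
      ∷ (pes (≁-sym xs) (~-sym xt) ∷ ~⇒≢ sv ∷ [])
      ∷ (~⇒≢ tv ∷ [])
      ∷ [] ∷ []

-- Prime graphs of claw centres, and soundness of the certificates

-- All consequences drawn are refutations, so claws and decidability are supplied in continuation
-- form.
record PrimeClawGraph : Set₁ where
  field
    V : Set
    _≟ᵥ_ : DecidableEquality V
    E : V → V → Bool
    E-sym : ∀ x y → E x y ≡ E y x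
    E-irrefl : ∀ x → E x x ≡ false
    claw : ∀ v → (∀ a b c → E v a ≡ true → E v b ≡ true → E v c ≡ true →
      a ≢ b → a ≢ c → b ≢ c → E a b ≡ false → E a c ≡ false → E b c ≡ false → ⊥) → ⊥
    prime : ∀ (K : V → Bool) x y z → x ≢ y → K x ≡ true → K y ≡ true → K z ≡ false →
      (∀ u a b → K u ≡ false → K a ≡ true → K b ≡ true → E u a ≡ E u b) → ⊥
    -- Classical reasoning over the finitely many vertices.
    deciding : ∀ (Q : V → Set) → ((∀ v → Dec (Q v)) → ⊥) → ⊥

module Certificates (G : PrimeClawGraph) where
  open PrimeClawGraph G
  open Listing E E-sym E-irrefl public
  open DecMembership _≟ᵥ_ using (_∈?_)

  module _ {Φ : List Rows} (avoids : All Avoids Φ) where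

    free-rows : ∀ xs → Unique xs → free Φ (rows xs) ≡ true
    free-rows xs u = all⇐ _ Φ absent
      where
      absent : ∀ {P} → P ∈ Φ → not (has (rows xs) P (upTo (length (rows xs))) (λ _ → true)) ≡ true
      absent {P} P∈ with has (rows xs) P (upTo (length (rows xs))) (λ _ → true) in eq
      ... | false = refl
      ... | true with has⇒ (rows xs) P _ _ eq
      ...   | is , is⊆ , v , refl , _ with <⇒Atₛ is (upTo⇒< xs ∘ is⊆)
      ...     | ys , ps =
        ⊥-elim (lookup avoids P∈ ys (Atₛ-Unique u v ps) (sym (pick-rows ps)))

    type-rows : ∀ x xs → Unique (x ∷ xs) → map (E x) xs ∈ types Φ (rows xs)
    type-rows x xs u =
      ∈-filter⁺ _ (subst (λ n → map (E x) xs ∈ bits n)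
                         (trans (length-map (E x) xs) (sym (length-rows xs)))
                         (bits-complete (map (E x) xs)))
                  (free-rows (x ∷ xs) u)

    -- The module is the set of vertices outside `xs` with row `t`, and the head of `xs` is the
    -- vertex outside it. Whether two members are adjacent is unknown, so the certificate must
    -- refute a separating vertex in both cases.
    lonely-rows : ∀ xs t → Unique xs → lonely Φ (rows xs) t ≡ true → ∀ h k → h ≢ k →
      h ∉ xs → k ∉ xs → map (E h) xs ≡ t → map (E k) xs ≡ t → ⊥
    lonely-rows xs@(x ∷ _) t u q h k h≢k h∉ k∉ ht kt =
      prime (does ∘ member?) h k x h≢k (dec-true (member? h) (h∉ , ht))
        (dec-true (member? k) (k∉ , kt)) (dec-false (member? x) (λ m → proj₁ m (here refl))) uniform
      where
      member? : ∀ y → Dec (y ∉ xs × map (E y) xs ≡ t)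
      member? y = ¬? (y ∈? xs) ×-dec (map (E y) xs ≟ᵣ t)

      separated : ∀ {y a b} → y ∉ xs → map (E y) xs ≢ t → a ∉ xs → b ∉ xs →
        map (E a) xs ≡ t → map (E b) xs ≡ t →
        E y a ≡ true → E y b ≡ false → ⊥
      separated {y} {a} {b} y∉ y≢t a∉ b∉ at≡ bt≡ ya yb
        = clashing (E a b)
            (subst (λ S → free Φ S ≡ true) rows≡ (free-rows (y ∷ a ∷ b ∷ xs) distinct))
        where
        yr = map (E y) xs

        clashing : ∀ c → free Φ ((true ∷ false ∷ yr) ∷ (c ∷ t) ∷ t ∷ rows xs) ≡ true → ⊥
        clashing c f
          with c | f | both {not (free Φ ((true ∷ false ∷ yr) ∷ (true ∷ t) ∷ t ∷ rows xs))}
            (right (dec-false (yr ≟ᵣ t) y≢t) (all⇒ _ q (type-rows y xs (¬Any⇒All¬ _ y∉ ∷ u))))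
        ... | true | f′ | c₁ , _ = case trans (sym f′) (not⇒false c₁) of λ ()
        ... | false | f′ | _ , c₂ = case trans (sym f′) (not⇒false c₂) of λ ()

        rows≡ : rows (y ∷ a ∷ b ∷ xs) ≡ (true ∷ false ∷ yr) ∷ (E a b ∷ t) ∷ t ∷ rows xs
        rows≡ rewrite ya | yb | at≡ | bt≡ = refl

        distinct : Unique (y ∷ a ∷ b ∷ xs)
        distinct =
          ((λ { refl → y≢t at≡ }) ∷ (λ { refl → y≢t bt≡ }) ∷ ¬Any⇒All¬ _ y∉)
          ∷ ((λ { refl → case trans (sym ya) yb of λ () }) ∷ ¬Any⇒All¬ _ a∉)
          ∷ ¬Any⇒All¬ _ b∉ ∷ u

      uniform : ∀ y a b → does (member? y) ≡ false → does (member? a) ≡ true →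
        does (member? b) ≡ true → E y a ≡ E y b
      uniform y a b ym am bm with does⇒ (member? a) am | does⇒ (member? b) bm
      ... | a∉ , at≡ | b∉ , bt≡ = split (y ∈? xs)
        where
        unlike : y ∉ xs → map (E y) xs ≢ t
        unlike y∉ yt = case trans (sym ym) (dec-true (member? y) (y∉ , yt)) of λ ()

        split : Dec (y ∈ xs) → E y a ≡ E y b
        split (yes y∈) =
          trans (E-sym y a) (trans (map≡⇒ (trans at≡ (sym bt≡)) y∈) (E-sym b y))
        split (no y∉) with E y a in ya | E y b in yb
        ... | true | true = refl
        ... | false | false = refl
        ... | true | false = ⊥-elim (separated y∉ (unlike y∉) a∉ b∉ at≡ bt≡ ya yb)
        ... | false | true = ⊥-elim (separated y∉ (unlike y∉) b∉ a∉ bt≡ at≡ yb ya)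

    old-rows : ∀ xs {i j x y} → x ≢ y → E x y ≡ false → At xs i x → At xs j y →
      apart Φ (rows xs) (old i) (old j) ≡ true
    old-rows xs {i} {j} x≢y xy p q
      rewrite dec-false (i ≟ j) (λ { refl → x≢y (At-functional p q) }) | entry-rows p q | xy = refl

    Is : List V → V → Kind → Set
    Is xs x (old i) = At xs i x
    Is xs x (new r) = x ∉ xs × map (E x) xs ≡ r

    apart-rows : ∀ xs → Unique xs → ∀ {x y} k l → Is xs x k → Is xs y l → x ≢ y →
      E x y ≡ false → apart Φ (rows xs) k l ≡ true
    apart-rows xs u (old i) (old j) p q x≢y xy = old-rows xs x≢y xy p q
    apart-rows xs u {x} {y} (old i) (new r) p (_ , refl) _ xy
      rewrite at-map (E y) p | E-sym y x | xy = refl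
    apart-rows xs u {x} (new r) (old j) (_ , refl) q _ xy
      rewrite at-map (E x) q | xy = refl
    apart-rows xs u {x} {y} (new r) (new s) (x∉ , xr) (y∉ , ys) x≢y xy =
      conj different (subst (λ S → free Φ S ≡ true) rows≡
        (free-rows (x ∷ y ∷ xs) ((x≢y ∷ ¬Any⇒All¬ _ x∉) ∷ ¬Any⇒All¬ _ y∉ ∷ u)))
      where
      rows≡ : rows (x ∷ y ∷ xs) ≡ (false ∷ r) ∷ s ∷ rows xs
      rows≡ rewrite xy | xr | ys = refl

      different : not (does (r ≟ᵣ s) ∧ lonely Φ (rows xs) r) ≡ true
      different with r ≟ᵣ s | lonely Φ (rows xs) r in l
      ... | no _ | _ = refl
      ... | yes _ | false = refl
      ... | yes refl | true = ⊥-elim (lonely-rows xs r u l x y x≢y x∉ y∉ xr ys)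

    not-clone : ∀ xs → Unique xs → ∀ x → x ∉ xs → ∀ {h} → h < length xs →
      not (clone Φ (rows xs) (map (E x) xs) h) ≡ true
    not-clone xs u x x∉ {h} h< with clone Φ (rows xs) (map (E x) xs) h in eq
    ... | false = refl
    ... | true with both {does (map (at (map (E x) xs)) (others (rows xs) h) ≟ᵣ _)} eq
    ...   | same , l with <⇒At h< | <⇒Atₛ (others (rows xs) h) (upTo⇒< xs ∘ proj₁ ∘ others-∈ (rows xs) h)
    ...     | y , p | zs , ps =
      ⊥-elim (lonely-rows zs _ (Atₛ-Unique u (others-Unique (rows xs) h) ps)
        (subst (λ R → lonely Φ R _ ≡ true) (pick-rows ps) l) x y
        (λ { refl → x∉ (At⇒∈ p) }) x∉zs y∉zs
        (trans (sym (at-maps (E x) ps)) (does⇒ (_ ≟ᵣ _) same)) (sym (entries-rows p ps)))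
      where
      x∉zs : x ∉ zs
      x∉zs x∈ = x∉ (At⇒∈ (proj₂ (proj₂ (Atₛ-∈ ps x∈))))

      y∉zs : y ∉ zs
      y∉zs y∈ with Atₛ-∈ ps y∈
      ... | i , i∈ , q = proj₂ (others-∈ (rows xs) h i∈) (At-injective u q p)

    kind : ∀ xs → Unique xs → ∀ {i v} → At xs i v → ∀ x → E v x ≡ true →
      ∃ λ k → Is xs x k × k ∈ kinds Φ (rows xs) i
    kind xs u {i} {v} p x vx with x ∈? xs
    ... | yes x∈ with ∈⇒At x∈
    ...   | j , q = old j , q , ∈-++⁺ˡ (∈-map⁺ old (∈-filter⁺ _ (At⇒upTo q) (trans (entry-rows p q) vx)))
    kind xs u {i} {v} p x vx | no x∉ =
      new (map (E x) xs) , (x∉ , refl) ,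
      ∈-++⁺ʳ _ (∈-map⁺ new (∈-filter⁺ _ (type-rows x xs (¬Any⇒All¬ _ x∉ ∷ u))
        (conj (trans (at-map (E x) p) (trans (E-sym x v) vx))
              (all⇐ _ _ (not-clone xs u x x∉ ∘ upTo⇒< xs)))))

    -- The vertex at index `v` of a copy of `S` is a claw centre. Its three leaves have kinds listed
    -- in `kinds`, pairwise `apart`, which the computed check denies.
    clawless-avoids : ∀ S v {_ : True (v <? length S)} → clawless Φ S v ≡ true → Avoids S
    clawless-avoids _ v {v<} q xs u refl with <⇒At (subst (v <_) (length-rows xs) (toWitness v<))
    ... | y , p = claw y noClaw
      where
      noClaw : ∀ a b c → E y a ≡ true → E y b ≡ true → E y c ≡ true →
        a ≢ b → a ≢ c → b ≢ c → E a b ≡ false → E a c ≡ false → E b c ≡ false → ⊥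
      noClaw a b c ya yb yc a≢b a≢c b≢c ab ac bc
        with kind xs u p a ya | kind xs u p b yb | kind xs u p c yc
      ... | k , isk , k∈ | l , isl , l∈ | m , ism , m∈ =
        case trans (sym (apart-rows xs u l m isl ism b≢c bc)) (not⇒false
          (all⇒ _ (all⇒ _ (all⇒ _ q k∈)
            (∈-filter⁺ _ l∈ (apart-rows xs u k l isk isl a≢b ab)))
            (∈-filter⁺ _ m∈ (apart-rows xs u k m isk ism a≢c ac)))) of λ ()

-- From forbidden patterns to a bipartition

module Bipartition (G : PrimeClawGraph)
  (no-chair : Certificates.Avoids G chairʳ) (no-gem : Certificates.Avoids G gemʳ) where
  open PrimeClawGraph G
  open Certificates G

  no-fan⁻ : Avoids fan⁻
  no-fan⁻ = clawless-avoids (no-chair ∷ no-gem ∷ []) fan⁻ 0 fan⁻-clawless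

  no-bull : Avoids bull
  no-bull = clawless-avoids (no-fan⁻ ∷ no-chair ∷ no-gem ∷ []) bull 4 bull-clawless

  no-C₅ : Avoids C₅
  no-C₅ = clawless-avoids (no-bull ∷ no-chair ∷ no-gem ∷ []) C₅ 4 C₅-clawless

  no-prism⁻ : Avoids prism⁻
  no-prism⁻ = clawless-avoids (no-bull ∷ no-chair ∷ no-gem ∷ []) prism⁻ 5 prism⁻-clawless

  no-house : Avoids house
  no-house = clawless-avoids (no-prism⁻ ∷ no-bull ∷ no-chair ∷ no-gem ∷ []) house 4 house-clawless

  data Reach (z w x : V) : V → Set where
    start : Reach z w x x
    step : ∀ {a b} → Reach z w x a → a ~ b → b ~ z → b ≁ w → Reach z w x b

  -- The component of x in the neighbours of z not adjacent to w is a module: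
  -- a vertex separating two of its adjacent vertices creates a gem, house or bull.
  no-paw : ∀ {x y z w} → x ~ y → x ~ z → y ~ z → w ~ z → w ≁ x → w ≁ y → ⊥
  no-paw {x} {y} {z} {w} xy xz yz wz wx wy = deciding (Reach z w x) λ reach? →
    prime (does ∘ reach?) x y w (~⇒≢ xy) (dec-true (reach? x) start)
      (dec-true (reach? y) y-reached) (dec-false (reach? w) w-unreached)
      (λ u a b uk ak bk → trans (constant (unreached reach? uk) (does⇒ (reach? a) ak))
                                (sym (constant (unreached reach? uk) (does⇒ (reach? b) bk))))
    where
    y-reached : Reach z w x y
    y-reached = step start xy yz (≁-sym wy)

    ⇒~z : ∀ {a} → Reach z w x a → a ~ z
    ⇒~z start = xz
    ⇒~z (step _ _ az _) = az

    ⇒≁w : ∀ {a} → Reach z w x a → a ≁ w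
    ⇒≁w start = ≁-sym wx
    ⇒≁w (step _ _ _ aw) = aw

    w-unreached : ¬ Reach z w x w
    w-unreached start = excl xy wy
    w-unreached (step r aw _ _) = excl aw (⇒≁w r)

    unreached : (reach? : ∀ a → Dec (Reach z w x a)) → ∀ {u} → does (reach? u) ≡ false →
      ¬ Reach z w x u
    unreached reach? {u} uk r = case trans (sym uk) (dec-true (reach? u) r) of λ ()

    -- If `u` sees `z` but not `w`, it belongs to the component. If it sees both, `w`, `u`, `a`, `b`
    -- is an induced path in the neighbourhood of `z`. If it sees only `w`, the square `u`, `w`,
    -- `z`, `a` has the roof `b`. If it sees neither, the triangle `a`, `b`, `z` has the horns `u`
    -- and `w`.
    no-separation : ∀ {u a b} → ¬ Reach z w x u → Reach z w x a → Reach z w x b → a ~ b →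
      u ~ a → u ≁ b → ⊥
    no-separation {u} {a} {b} u∉ ra rb ab ua ub with ~? u z | ~? u w
    ... | inj₁ uz | inj₂ uw = u∉ (step ra (~-sym ua) uz uw)
    ... | inj₁ uz | inj₁ uw =
      gem-⊥ no-gem uw (⇒≁w ra) (~-sym ua) (⇒≁w rb) (≁-sym ub) (~-sym ab)
        (~-sym wz) (~-sym uz) (~-sym (⇒~z ra)) (~-sym (⇒~z rb))
    ... | inj₂ uz | inj₁ uw =
      house-⊥ no-house (~-sym uw) (≁-sym ub) (⇒≁w rb) (~-sym ua) (⇒≁w ra) ab
        (≁-sym uz) (~-sym wz) (~-sym (⇒~z rb)) (~-sym (⇒~z ra))
    ... | inj₂ uz | inj₂ uw =
      bull-⊥ no-bull (≁-sym uw) (≁-sym ub) (⇒≁w rb) (~-sym ua) (⇒≁w ra) ab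
        (≁-sym uz) (~-sym wz) (~-sym (⇒~z rb)) (~-sym (⇒~z ra))

    constant : ∀ {u a} → ¬ Reach z w x u → Reach z w x a → E u a ≡ E u x
    constant u∉ start = refl
    constant {u} {b} u∉ rb@(step {a} ra ab bz bw) with ~? u a | ~? u b
    ... | inj₁ ua | inj₁ ub = trans ub (trans (sym ua) (constant u∉ ra))
    ... | inj₂ ua | inj₂ ub = trans ub (trans (sym ua) (constant u∉ ra))
    ... | inj₁ ua | inj₂ ub = ⊥-elim (no-separation u∉ ra rb ab ua ub)
    ... | inj₂ ua | inj₁ ub = ⊥-elim (no-separation u∉ rb ra (~-sym ab) ub ua)

  -- Related to Olariu's theorem that a connected paw-free graph is triangle-free or complete
  -- multipartite. Without paws, a vertex sees none or at least two of `x`, `y`, `z`. Vertices of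
  -- the second sort have no neighbour of the first, so by primality all are of the second sort.
  -- Then the non-neighbours of `x`, with `x` itself, form a module, so `x` sees every other vertex,
  -- and these others are a module.
  no-triangle : ∀ {x y z} → x ~ y → x ~ z → y ~ z → ⊥
  no-triangle {x} {y} {z} xy xz yz =
    prime (λ p → not (does (p ≟ᵥ x))) y z x (~⇒≢ yz) (cong not (dec-false (y ≟ᵥ x) (~⇒≢ (~-sym xy))))
      (cong not (dec-false (z ≟ᵥ x) (~⇒≢ (~-sym xz)))) (cong not (dec-true (x ≟ᵥ x) refl)) uniform
    where
    Hit : V → Set
    Hit p = (p ~ x × p ~ y) ⊎ (p ~ x × p ~ z) ⊎ (p ~ y × p ~ z)

    hit? : ∀ p → Dec (Hit p)
    hit? p = (E p x Bool.≟ true ×-dec E p y Bool.≟ true)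
      ⊎-dec (E p x Bool.≟ true ×-dec E p z Bool.≟ true)
      ⊎-dec (E p y Bool.≟ true ×-dec E p z Bool.≟ true)

    missed : ∀ {u} → ¬ Hit u → u ≁ x × u ≁ y × u ≁ z
    missed {u} ¬h with ~? u x | ~? u y | ~? u z
    ... | inj₂ ux | inj₂ uy | inj₂ uz = ux , uy , uz
    ... | inj₁ ux | inj₁ uy | _ = contradiction (inj₁ (ux , uy)) ¬h
    ... | inj₁ ux | inj₂ uy | inj₁ uz = contradiction (inj₂ (inj₁ (ux , uz))) ¬h
    ... | inj₂ ux | inj₁ uy | inj₁ uz = contradiction (inj₂ (inj₂ (uy , uz))) ¬h
    ... | inj₁ ux | inj₂ uy | inj₂ uz = ⊥-elim (no-paw yz (~-sym xy) (~-sym xz) ux uy uz)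
    ... | inj₂ ux | inj₁ uy | inj₂ uz = ⊥-elim (no-paw xz xy (~-sym yz) uy ux uz)
    ... | inj₂ ux | inj₂ uy | inj₁ uz = ⊥-elim (no-paw xy xz yz uz ux uy)

    far : ∀ {u a} → ¬ Hit u → Hit a → u ≁ a
    far {u} {a} ¬h h = ¬~⇒≁ λ ua → case missed ¬h , h of λ where
      ((ux , uy , uz) , inj₁ (ax , ay)) → no-paw xy (~-sym ax) (~-sym ay) ua ux uy
      ((ux , uy , uz) , inj₂ (inj₁ (ax , az))) → no-paw xz (~-sym ax) (~-sym az) ua ux uz
      ((ux , uy , uz) , inj₂ (inj₂ (ay , az))) → no-paw yz (~-sym ay) (~-sym az) ua uy uz

    all-hit : ∀ p → Hit p
    all-hit p with hit? p
    ... | yes h = h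
    ... | no ¬h = ⊥-elim (prime (does ∘ hit?) x y p (~⇒≢ xy)
      (dec-true (hit? x) (inj₂ (inj₂ (xy , xz)))) (dec-true (hit? y) (inj₂ (inj₁ (~-sym xy , yz))))
      (dec-false (hit? p) ¬h)
      (λ u a b uk ak bk → trans (far (unhit uk) (does⇒ (hit? a) ak))
                                (sym (far (unhit uk) (does⇒ (hit? b) bk)))))
      where
      unhit : ∀ {u} → does (hit? u) ≡ false → ¬ Hit u
      unhit {u} uk h = case trans (sym uk) (dec-true (hit? u) h) of λ ()

    universal : ∀ {p} → p ≢ x → x ~ p
    universal {p} p≢x with ~? x p
    ... | inj₁ xp = xp
    ... | inj₂ xp = ⊥-elim (prime (λ a → not (E x a)) x p y (p≢x ∘ sym) (cong not (E-irrefl x))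
      (cong not xp) (cong not xy) (λ u a b uk ak bk → trans (joined uk ak) (sym (joined uk bk))))
      where
      other : ∀ {a} → x ≁ a → a ~ y × a ~ z
      other {a} xa with all-hit a
      ... | inj₁ (ax , _) = ⊥-elim (excl (~-sym ax) xa)
      ... | inj₂ (inj₁ (ax , _)) = ⊥-elim (excl (~-sym ax) xa)
      ... | inj₂ (inj₂ r) = r

      joined : ∀ {u a} → not (E x u) ≡ false → not (E x a) ≡ true → u ~ a
      joined {u} {a} uk ak with ~? x u | ~? u a | other (not⇒false ak) | all-hit u
      ... | _ | inj₁ ua | _ | _ = ua
      ... | inj₂ xu | _ | _ | _ = case trans (sym uk) (cong not xu) of λ ()
      ... | inj₁ xu | inj₂ ua | ay , az | inj₁ (_ , uy) =
        ⊥-elim (no-paw xu xy uy ay (≁-sym (not⇒false ak)) (≁-sym ua))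
      ... | inj₁ xu | inj₂ ua | ay , az | inj₂ (inj₁ (_ , uz)) =
        ⊥-elim (no-paw xu xz uz az (≁-sym (not⇒false ak)) (≁-sym ua))
      ... | inj₁ xu | inj₂ ua | ay , az | inj₂ (inj₂ (uy , _)) =
        ⊥-elim (no-paw xu xy uy ay (≁-sym (not⇒false ak)) (≁-sym ua))

    uniform : ∀ u a b → not (does (u ≟ᵥ x)) ≡ false → not (does (a ≟ᵥ x)) ≡ true →
      not (does (b ≟ᵥ x)) ≡ true → E u a ≡ E u b
    uniform u a b uk ak bk with u ≟ᵥ x | a ≟ᵥ x | b ≟ᵥ x
    ... | yes refl | no a≢x | no b≢x = trans (universal a≢x) (sym (universal b≢x))

  stable : ∀ {v x y} → v ~ x → v ~ y → x ≁ y
  stable vx vy = ¬~⇒≁ (no-triangle vx vy)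

  Near : V → V → Set
  Near v u = ∃ λ t → v ~ t × t ~ u

  -- Otherwise a neighbour common to v and e gives a chair centred at v.
  twice : ∀ {v e} → Near v e →
    (∀ {s t} → s ≢ t → v ~ s → v ~ t → e ~ s → e ~ t → ⊥) → ⊥
  twice {v} {e} (t , vt , te) k = claw v λ a b c va vb vc a≢b a≢c b≢c ab ac bc →
    let attached : ∀ {p q r} → v ~ p → v ~ q → v ~ r → q ≢ p → r ~ e → e ≁ p → e ≁ q → ⊥
        attached vp vq vr q≢p re ep eq =
          chair-⊥ no-chair (~-sym vp) (~-sym vq) (stable vq vp) (~-sym vr) (stable vr vp) (stable vr vq)
            (≁-sym (¬~⇒≁ (λ ve → no-triangle ve vr (~-sym re)))) ep eq (~-sym re) q≢p
    in case ~? e a , ~? e b , ~? e c of λ where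
      (inj₁ ea , inj₁ eb , _) → k a≢b va vb ea eb
      (inj₁ ea , inj₂ _ , inj₁ ec) → k a≢c va vc ea ec
      (inj₂ _ , inj₁ eb , inj₁ ec) → k b≢c vb vc eb ec
      (inj₁ ea , inj₂ eb , inj₂ ec) → attached vb vc va (b≢c ∘ sym) (~-sym ea) eb ec
      (inj₂ ea , inj₁ eb , inj₂ ec) → attached va vc vb (a≢c ∘ sym) (~-sym eb) ea ec
      (inj₂ ea , inj₂ eb , inj₁ ec) → attached va vb vc (a≢b ∘ sym) (~-sym ec) ea eb
      (inj₂ ea , inj₂ eb , inj₂ ec) → attached va vb vt (a≢b ∘ sym) te ea eb

  -- One side is `Near v`, the ends of walks of length two from `v`. An edge inside it yields a
  -- triangle or an induced C₅; an edge outside it yields a part of the graph cut off from `v`.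
  bipartition : V → (∀ (side : V → Bool) → (∀ x y → x ~ y → side x ≢ side y) → ⊥) → ⊥
  bipartition v k = deciding (Near v) λ near? →
    k (does ∘ near?) λ x y xy eq → case near? x , near? y of λ where
      (yes nx , yes ny) → inside nx ny xy
      (no ¬nx , no ¬ny) → outside ¬nx ¬ny xy
      (yes nx , no ¬ny) → case trans (sym (dec-true (near? x) nx)) (trans eq (dec-false (near? y) ¬ny)) of λ ()
      (no ¬nx , yes ny) → case trans (sym (dec-false (near? x) ¬nx)) (trans eq (dec-true (near? y) ny)) of λ ()
    where
    inside : ∀ {x y} → Near v x → Near v y → x ~ y → ⊥
    inside (t , vt , tx) (s , vs , sy) xy =
      C₅-⊥ no-C₅ (~-sym vt) (~-sym vs) (stable vs vt) x≁v (~-sym tx) x≁s y≁v y≁t (~-sym sy) (~-sym xy)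
      where
      x≁v = ¬~⇒≁ λ xv → no-triangle vt (~-sym xv) tx
      y≁v = ¬~⇒≁ λ yv → no-triangle vs (~-sym yv) sy
      x≁s = ¬~⇒≁ λ xs → no-triangle xs xy sy
      y≁t = ¬~⇒≁ λ yt → no-triangle yt (~-sym xy) tx

    -- By `twice`, `e` and `v` have two common neighbours; they are the leaves of a chair centred at
    -- `e` whose long arm is `x`, `y`.
    end : ∀ {e x y} → Near v e → e ~ x → ¬ Near v x → ¬ Near v y → x ~ y → ⊥
    end {e} {x} {y} ne ex ¬nx ¬ny xy = twice ne λ {s} {t} s≢t vs vt es et →
      chair-⊥ no-chair (~-sym es) (~-sym et) (stable vt vs) (~-sym ex)
        (¬~⇒≁ λ xs → ¬nx (s , vs , ~-sym xs)) (¬~⇒≁ λ xt → ¬nx (t , vt , ~-sym xt))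
        (¬~⇒≁ λ ye → no-triangle ex (~-sym ye) xy)
        (¬~⇒≁ λ ys → ¬ny (s , vs , ~-sym ys)) (¬~⇒≁ λ yt → ¬ny (t , vt , ~-sym yt))
        (~-sym xy) (s≢t ∘ sym)

    -- Chosen so that all neighbours of a far vertex are far; the other vertices then form a module.
    Far : V → Set
    Far u = ¬ Near v u × v ≁ u × (∀ e → e ~ u → ¬ Near v e)

    outside : ∀ {x y} → ¬ Near v x → ¬ Near v y → x ~ y → ⊥
    -- The claw at `v` provides a neighbour `a`, the second vertex of the module.
    outside {x} {y} ¬nx ¬ny xy = deciding Far λ far? → claw v λ a _ _ va _ _ _ _ _ _ _ _ →
      prime (not ∘ does ∘ far?) v a x (~⇒≢ va)
        (cong not (dec-false (far? v) λ f → proj₁ f (a , va , ~-sym va)))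
        (cong not (dec-false (far? a) λ f → excl va (proj₁ (proj₂ f))))
        (cong not (dec-true (far? x) (far ¬nx ¬ny xy)))
        (λ u p q uk pk qk → trans (closed far? uk pk) (sym (closed far? uk qk)))
      where
      far : ∀ {x y} → ¬ Near v x → ¬ Near v y → x ~ y → Far x
      far ¬nx ¬ny xy = ¬nx , ¬~⇒≁ (λ vx → ¬ny (_ , vx , xy)) , λ e ex ne → end ne ex ¬nx ¬ny xy

      closed : (far? : ∀ u → Dec (Far u)) → ∀ {u p} → not (does (far? u)) ≡ false →
        not (does (far? p)) ≡ true → u ≁ p
      closed far? {u} {p} uk pk with far? u | far? p
      ... | yes (¬nu , _ , ¬n) | no ¬fp =
        ¬~⇒≁ λ up → ¬fp (far (¬n p (~-sym up)) ¬nu (~-sym up))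

-- Counting, decidability and vertex deletion

lookup-injective : ∀ {A : Set} {xs : List A} → Unique xs → ∀ i j →
  List.lookup xs i ≡ List.lookup xs j → i ≡ j
lookup-injective (_ ∷ _) zero zero _ = refl
lookup-injective (x∉ ∷ _) zero (suc j) eq = contradiction (subst (_∈ _) (sym eq) (∈-lookup j)) (All¬⇒¬Any x∉)
lookup-injective (x∉ ∷ _) (suc i) zero eq = contradiction (subst (_∈ _) eq (∈-lookup i)) (All¬⇒¬Any x∉)
lookup-injective (_ ∷ u) (suc i) (suc j) eq = cong suc (lookup-injective u i j eq)

Unique-⊆-length : ∀ {A : Set} {xs ys : List A} → Unique xs → (∀ {x} → x ∈ xs → x ∈ ys) →
  length xs ≤ length ys
Unique-⊆-length {xs = xs} {ys} u sub = injective⇒≤ {f = position} λ {i} {j} eq →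
  lookup-injective u i j (trans (lookup-index (sub (∈-lookup i)))
    (trans (cong (List.lookup ys) eq) (sym (lookup-index (sub (∈-lookup j))))))
  where
  position : Fin (length xs) → Fin (length ys)
  position i = index (sub (∈-lookup i))

unused : ∀ {k} (L : List (Fin k)) → length L < k → ∃ λ i → i ∉ L
unused {k} L short with any? (λ i → ¬? (Any.any? (i Fin.≟_) L))
... | yes found = found
... | no all-used = contradiction
  (subst (_≤ length L) (length-tabulate id)
    (Unique-⊆-length (allFin⁺ k) (λ {i} _ → decidable-stable (Any.any? (i Fin.≟_) L) (all-used ∘ (i ,_)))))
  (ℕ.<⇒≱ short)

module _ {k : ℕ} where

  -- Functions are enumerated only up to pointwise equality, so `P` must respect it.
  function? : ∀ n (P : (Fin n → Fin k) → Set) → (∀ {f g} → f ≗ g → P f → P g) →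
    (∀ f → Dec (P f)) → Dec (∃ P)
  function? zero P resp P? = map′ (_ ,_) (λ { (f , p) → resp (λ ()) p }) (P? λ ())
  function? (suc n) P resp P? =
    map′ (λ { (i , f , p) → i Vector.∷ f , p })
         (λ { (f , p) → f zero , f ∘ suc , resp (λ { zero → refl ; (suc _) → refl }) p })
         (any? λ i → function? n (λ f → P (i Vector.∷ f))
           (λ eq → resp λ { zero → refl ; (suc j) → eq j }) (λ f → P? (i Vector.∷ f)))

  colourable? : ∀ {n} (G : Graph n) → Dec (χ≤ G k)
  colourable? {n} G = function? n _
    (λ eq proper u v uv cu≡cv → proper u v uv (trans (eq u) (trans cu≡cv (sym (eq v)))))
    (λ c → all? λ u → all? λ v → (adj G u v Bool.≟ true) →-dec ¬? (c u Fin.≟ c v))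

delete : ∀ {n} → Graph (suc n) → Fin (suc n) → Graph n
delete G x = record
  { adj = λ u v → adj G (punchIn x u) (punchIn x v)
  ; sym = λ u v → Graph.sym G _ _
  ; irrefl = λ v → irrefl G _
  }

delete-Free : ∀ {n k} (G : Graph (suc n)) x {H : Fin k → Fin k → Bool} → G Free H → delete G x Free H
delete-Free G x free (f , inj , eq) = free (punchIn x ∘ f , inj ∘ punchIn-injective x _ _ , eq)

delete-HasClique : ∀ {n} (G : Graph (suc n)) x {k} → HasClique (delete G x) k → HasClique G k
delete-HasClique G x (f , inj , eq) = punchIn x ∘ f , inj ∘ punchIn-injective x _ _ , eq

-- `opposite` turns the numbering of the pattern into the newest-first order of rows.
Matches : ∀ {k} → Rows → (Fin k → Fin k → Bool) → Set
Matches S H = ∀ i j → i ≢ j → entry S (toℕ (opposite i)) (toℕ (opposite j)) ≡ H i j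

matches? : ∀ {k} S (H : Fin k → Fin k → Bool) → Dec (Matches S H)
matches? S H = all? λ i → all? λ j →
  ¬? (i Fin.≟ j) →-dec (entry S (toℕ (opposite i)) (toℕ (opposite j)) Bool.≟ H i j)

module OnGraph {n : ℕ} (G : Graph n) where
  open Listing (adj G) (Graph.sym G) (irrefl G) public

  Free⇒Avoids : ∀ {k} (H : Fin k → Fin k → Bool) S → length S ≡ k → G Free H →
    Matches S H → Avoids S
  Free⇒Avoids {k} H S eq free match xs u refl with trans (sym (length-rows xs)) eq
  ... | refl = free (vertex ∘ opposite , injective , λ i j i≢j →
      trans (sym (entry-rows (At-lookup xs (opposite i)) (At-lookup xs (opposite j)))) (match i j i≢j))
    where
    vertex = List.lookup xs

    injective : ∀ {i j} → vertex (opposite i) ≡ vertex (opposite j) → i ≡ j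
    injective {i} {j} e = trans (sym (Fin.opposite-involutive i))
      (trans (cong opposite (lookup-injective u _ _ e)) (Fin.opposite-involutive j))

    At-lookup : ∀ ys i → At {Fin n} ys (toℕ i) (List.lookup ys i)
    At-lookup (y ∷ ys) zero = here
    At-lookup (y ∷ ys) (suc i) = there (At-lookup ys i)

  Clique : List (Fin n) → Set
  Clique = AllPairs _~_

  Clique⇒HasClique : ∀ {Q} → Clique Q → HasClique G (length Q)
  Clique⇒HasClique {Q} cl = List.lookup Q , (λ {i} {j} → injective i j) , pairwise cl
    where
    pairwise : ∀ {Q} → Clique Q → ∀ i j → i ≢ j → List.lookup Q i ~ List.lookup Q j
    pairwise (_ ∷ _) zero zero i≢j = contradiction refl i≢j
    pairwise (a ∷ _) zero (suc j) _ = All.lookup a (∈-lookup j)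
    pairwise (a ∷ _) (suc i) zero _ = ~-sym (All.lookup a (∈-lookup i))
    pairwise (_ ∷ c) (suc i) (suc j) i≢j = pairwise c i j (i≢j ∘ cong suc)

    injective : ∀ i j → List.lookup Q i ≡ List.lookup Q j → i ≡ j
    injective i j eq with i Fin.≟ j
    ... | yes i≡j = i≡j
    ... | no i≢j = contradiction eq (~⇒≢ (pairwise cl i j i≢j))

  Clique-intro : ∀ {xs} → Unique xs → (∀ {a b} → a ∈ xs → b ∈ xs → a ≢ b → a ~ b) → Clique xs
  Clique-intro [] _ = []
  Clique-intro (x∉ ∷ u) h =
    tabulate (λ y∈ → h (here refl) (there y∈) (All.lookup x∉ y∈))
    ∷ Clique-intro u (λ a∈ b∈ → h (there a∈) (there b∈))

  Clique-lookup : ∀ {Q} → Clique Q → ∀ {a b} → a ∈ Q → b ∈ Q → a ≢ b → a ~ b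
  Clique-lookup (_ ∷ _) (here refl) (here refl) a≢b = contradiction refl a≢b
  Clique-lookup (x ∷ _) (here refl) (there b∈) _ = All.lookup x b∈
  Clique-lookup (x ∷ _) (there a∈) (here refl) _ = ~-sym (All.lookup x a∈)
  Clique-lookup (_ ∷ c) (there a∈) (there b∈) a≢b = Clique-lookup c a∈ b∈ a≢b

  -- Cliques in P₄-free neighbourhoods

  module Neighbourhood (no-gem : Avoids gemʳ) (z : Fin n) where

    Triple : List (Fin n) → Set
    Triple X = ∃ λ a → ∃ λ b → ∃ λ c → (a ∈ X × b ∈ X × c ∈ X) ×
      (a ≢ b × a ≢ c × b ≢ c) × (a ≁ b × a ≁ c × b ≁ c)

    -- `S` is a maximal stable subset of `X` and `R` the rest; `dominated` expresses maximality.
    record Peel (X : List (Fin n)) : Set where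
      field
        S R : List (Fin n)
        S⊆ : ∀ {x} → x ∈ S → x ∈ X
        R⊆ : ∀ {x} → x ∈ R → x ∈ X
        cover : ∀ {x} → x ∈ X → x ∈ S ⊎ x ∈ R
        sizes : length X ≡ length S + length R
        S-stable : AllPairs (λ a b → a ≢ b × a ≁ b) S
        R-unique : Unique R
        dominated : ∀ {x} → x ∈ R → ∃ λ s → s ∈ S × x ~ s

    peel : ∀ X → Unique X → Peel X
    peel [] [] = record
      { S = [] ; R = [] ; S⊆ = id ; R⊆ = id ; cover = λ () ; sizes = refl
      ; S-stable = [] ; R-unique = [] ; dominated = λ () }
    peel (x ∷ X) (x∉ ∷ u) with peel X u
    ... | record { S = S ; R = R ; S⊆ = S⊆ ; R⊆ = R⊆ ; cover = cover ; sizes = sizes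
                 ; S-stable = stab ; R-unique = uR ; dominated = dom }
      with Any.any? (λ s → adj G x s Bool.≟ true) S
    ... | yes hit = record
      { S = S ; R = x ∷ R ; S⊆ = there ∘ S⊆
      ; R⊆ = λ { (here refl) → here refl ; (there r∈) → there (R⊆ r∈) }
      ; cover = λ { (here refl) → inj₂ (here refl)
                  ; (there y∈) → [ inj₁ , inj₂ ∘ there ]′ (cover y∈) }
      ; sizes = trans (cong suc sizes) (sym (ℕ.+-suc (length S) (length R)))
      ; S-stable = stab
      ; R-unique = tabulate (λ r∈ → All.lookup x∉ (R⊆ r∈)) ∷ uR
      ; dominated = λ { (here refl) → find hit ; (there r∈) → dom r∈ } }
    ... | no miss = record
      { S = x ∷ S ; R = R
      ; S⊆ = λ { (here refl) → here refl ; (there s∈) → there (S⊆ s∈) }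
      ; R⊆ = there ∘ R⊆
      ; cover = λ { (here refl) → inj₁ (here refl)
                  ; (there y∈) → [ inj₁ ∘ there , inj₂ ]′ (cover y∈) }
      ; sizes = cong suc sizes
      ; S-stable = tabulate (λ s∈ → All.lookup x∉ (S⊆ s∈) , ¬~⇒≁ (λ xs → miss (lose s∈ xs))) ∷ stab
      ; R-unique = uR
      ; dominated = λ r∈ → let s , s∈ , rs = dom r∈ in s , there s∈ , rs }

    stable-≁ : ∀ {S} → AllPairs (λ a b → a ≢ b × a ≁ b) S → ∀ {a b} → a ∈ S → b ∈ S → a ≁ b
    stable-≁ (_ ∷ _) (here refl) (here refl) = irrefl G _
    stable-≁ (x ∷ _) (here refl) (there b∈) = proj₂ (All.lookup x b∈)
    stable-≁ (x ∷ _) (there a∈) (here refl) = ≁-sym (proj₂ (All.lookup x a∈))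
    stable-≁ (_ ∷ st) (there a∈) (there b∈) = stable-≁ st a∈ b∈

    stable-size : ∀ {X S} → (∀ {x} → x ∈ S → x ∈ X) → AllPairs (λ a b → a ≢ b × a ≁ b) S →
      ¬ Triple X → length S ≤ 2
    stable-size {S = []} _ _ _ = z≤n
    stable-size {S = _ ∷ []} _ _ _ = s≤s z≤n
    stable-size {S = _ ∷ _ ∷ []} _ _ _ = s≤s (s≤s z≤n)
    stable-size {S = a ∷ b ∷ c ∷ _} sub (((a≢b , ab) ∷ (a≢c , ac) ∷ _) ∷ ((b≢c , bc) ∷ _) ∷ _) no3 =
      contradiction (a , b , c , (sub (here refl) , sub (there (here refl)) , sub (there (there (here refl))))
        , (a≢b , a≢c , b≢c) , (ab , ac , bc)) no3

    -- Chvátal's argument: in a P₄-free graph a clique whose vertices all have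
    -- neighbours in a stable set S has a common neighbour in S.
    common : ∀ {S} → (∀ {a b} → a ∈ S → b ∈ S → a ≁ b) → (∀ {x} → x ∈ S → z ~ x) →
      ∀ {s₀} → s₀ ∈ S → ∀ {Q} → Clique Q → (∀ {q} → q ∈ Q → z ~ q) →
      (∀ {q} → q ∈ Q → ∃ λ s → s ∈ S × q ~ s) → ∃ λ s → s ∈ S × All (s ~_) Q
    common _ _ s₀∈ [] _ _ = _ , s₀∈ , []
    common {S} st zS s₀∈ {q ∷ Q} (qQ ∷ cl) zQ dom
      with common st zS s₀∈ cl (zQ ∘ there) (dom ∘ there)
    ... | s , s∈ , sQ with ~? s q
    ...   | inj₁ sq = s , s∈ , sq ∷ sQ
    ...   | inj₂ sq with dom (here refl)
    ...     | t , t∈ , qt with All.all? (λ p → adj G t p Bool.≟ true) Q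
    ...       | yes tQ = t , t∈ , ~-sym qt ∷ tQ
    ...       | no ¬tQ with find (¬All⇒Any¬ (λ p → adj G t p Bool.≟ true) Q ¬tQ)
    ...         | p , p∈ , ¬tp = ⊥-elim (gem-⊥ no-gem (~-sym (All.lookup sQ p∈)) (≁-sym sq)
      (All.lookup qQ p∈) (st t∈ s∈) (¬~⇒≁ ¬tp) (~-sym qt) (zS s∈) (zQ (there p∈))
      (zQ (here refl)) (zS t∈))

    -- One induction serves two purposes: `hom` folds a module into a clique, and `bound` limits a
    -- neighbourhood without stable triples.
    record Shrink (X : List (Fin n)) : Set where
      field
        Q : List (Fin n)
        clique : Clique Q
        Q⊆ : ∀ {x} → x ∈ Q → x ∈ X
        retract : Fin n → Fin n
        into : ∀ {x} → x ∈ X → retract x ∈ Q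
        hom : ∀ {x y} → x ∈ X → y ∈ X → x ~ y → retract x ~ retract y
        bound : ¬ Triple X → length X ≤ 2 * length Q

    -- Each round removes a maximal stable set, sends all of it to one of its vertices, and adds
    -- that vertex to the clique found in the rest. The number `m` only bounds the recursion.
    shrink : ∀ m X → length X ≤ m → Unique X → (∀ {x} → x ∈ X → z ~ x) → Shrink X
    shrink _ [] _ _ _ = record
      { Q = [] ; clique = [] ; Q⊆ = id ; retract = id ; into = id
      ; hom = λ () ; bound = λ _ → z≤n }
    shrink (suc m) X@(x₀ ∷ _) (s≤s X≤) u zX with peel X u
    ... | record { S = S ; R = R ; S⊆ = S⊆ ; R⊆ = R⊆ ; cover = cover ; sizes = sizes
                 ; S-stable = stab ; R-unique = uR ; dominated = dom } =
      extend (shrink m R (s≤s⁻¹ (ℕ.≤-trans R< (s≤s X≤))) uR (zX ∘ R⊆))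
      where
      S-inhabited : ∃ λ s → s ∈ S
      S-inhabited with cover (here refl)
      ... | inj₁ s∈ = _ , s∈
      ... | inj₂ r∈ = let s , s∈ , _ = dom r∈ in s , s∈

      R< : length R < length X
      R< = subst (length R <_) (sym sizes) (ℕ.m<n+m (length R) (∈-length (proj₂ S-inhabited)))

      extend : Shrink R → Shrink X
      extend sh = record
        { Q = s ∷ Q ; clique = sQ ∷ clique
        ; Q⊆ = λ { (here refl) → S⊆ s∈ ; (there q∈) → R⊆ (Q⊆ q∈) }
        ; retract = f ; into = f-into ; hom = f-hom ; bound = f-bound }
        where
        open Shrink sh

        found = common (stable-≁ stab) (zX ∘ S⊆) (proj₂ S-inhabited) clique (zX ∘ R⊆ ∘ Q⊆) (dom ∘ Q⊆)
        s = proj₁ found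
        s∈ = proj₁ (proj₂ found)
        sQ = proj₂ (proj₂ found)

        in-S? : ∀ x → Dec (x ∈ S)
        in-S? x = Any.any? (x Fin.≟_) S

        f : Fin n → Fin n
        f x = if does (in-S? x) then s else retract x

        rest : ∀ {x} → x ∈ X → x ∉ S → x ∈ R
        rest x∈ x∉ = [ (λ x∈S → contradiction x∈S x∉) , id ]′ (cover x∈)

        f-into : ∀ {x} → x ∈ X → f x ∈ s ∷ Q
        f-into {x} x∈ with in-S? x
        ... | yes _ = here refl
        ... | no x∉ = there (into (rest x∈ x∉))

        f-hom : ∀ {x y} → x ∈ X → y ∈ X → x ~ y → f x ~ f y
        f-hom {x} {y} x∈ y∈ xy with in-S? x | in-S? y
        ... | yes x∈S | yes y∈S = ⊥-elim (excl xy (stable-≁ stab x∈S y∈S))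
        ... | yes _ | no y∉ = All.lookup sQ (into (rest y∈ y∉))
        ... | no x∉ | yes _ = ~-sym (All.lookup sQ (into (rest x∈ x∉)))
        ... | no x∉ | no y∉ = hom (rest x∈ x∉) (rest y∈ y∉) xy

        f-bound : ¬ Triple X → length X ≤ 2 * suc (length Q)
        f-bound no3 = begin
          length X ≡⟨ sizes ⟩
          length S + length R ≤⟨ ℕ.+-mono-≤ (stable-size S⊆ stab no3) (bound no3′) ⟩
          2 + 2 * length Q ≡⟨ ℕ.*-suc 2 (length Q) ⟨
          2 * suc (length Q) ∎
          where
          open ℕ.≤-Reasoning
          no3′ : ¬ Triple R
          no3′ (a , b , c , (a∈ , b∈ , c∈) , r) = no3 (a , b , c , (R⊆ a∈ , R⊆ b∈ , R⊆ c∈) , r)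

pick-first : ∀ {A : Set} → (A → Bool) → List A → A → A
pick-first p [] d = d
pick-first p (y ∷ ys) d = if p y then y else pick-first p ys d

pick-first-true : ∀ {A : Set} (p : A → Bool) ys {d} → p d ≡ true → p (pick-first p ys d) ≡ true
pick-first-true p [] pd = pd
pick-first-true p (y ∷ ys) pd with p y in py
... | true = py
... | false = pick-first-true p ys pd

pick-first-cong : ∀ {A : Set} {p q : A → Bool} → p ≗ q → ∀ {ys d e x} → x ∈ ys → p x ≡ true →
  pick-first p ys d ≡ pick-first q ys e
pick-first-cong {p = p} {q} eq {y ∷ ys} x∈ px with p y in py | q y in qy
... | true | true = refl
... | true | false = case trans (sym py) (trans (eq y) qy) of λ ()
... | false | true = case trans (sym qy) (trans (sym (eq y)) py) of λ ()
pick-first-cong eq (here refl) px | false | false = case trans (sym px) py of λ ()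
pick-first-cong eq (there x∈) px | false | false = pick-first-cong eq x∈ px

¬¬-finite : ∀ {n} {P : Fin n → Set} → (∀ i → ¬ ¬ P i) → ¬ ¬ (∀ i → P i)
¬¬-finite {zero} _ k = k λ ()
¬¬-finite {suc n} h k = h zero λ p → ¬¬-finite (h ∘ suc) λ ps → k λ { zero → p ; (suc i) → ps i }

-- Minimal counterexamples and their twin quotient

module Critical {n : ℕ} (G : Graph (suc n)) (m : ℕ)
  (uncolourable : ¬ χ≤ G (2 * suc m ∸ 1)) (colour : ∀ x → χ≤ (delete G x) (2 * suc m ∸ 1))
  (clique≤ : ∀ j → HasClique G j → j ≤ suc m)
  (no-chair : OnGraph.Avoids G chairʳ) (no-gem : OnGraph.Avoids G gemʳ) where
  open OnGraph G

  k : ℕ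
  k = 2 * suc m ∸ 1

  Vertex : Set
  Vertex = Fin (suc n)

  -- Composing `f` with a colouring of G - x would colour G.
  no-folding : (f : Vertex → Vertex) → (∀ {u v} → u ~ v → f u ~ f v) → ∀ x → ¬ (∀ v → x ≢ f v)
  no-folding f hom x x≢ = uncolourable
    ( (λ v → c (punchOut (x≢ v)))
    , λ u v uv → proper _ _
        (trans (cong₂ (adj G) (punchIn-punchOut (x≢ u)) (punchIn-punchOut (x≢ v))) (hom uv)))
    where
    c = proj₁ (colour x)
    proper = proj₂ (colour x)

  -- Otherwise `K` takes its colours from G - y and the rest from G - x.
  no-cut : (K : Vertex → Bool) → ∀ x y → K x ≡ true → K y ≡ false →
    ¬ (∀ u v → K u ≡ false → K v ≡ true → u ≁ v)
  no-cut K x y Kx Ky across = uncolourable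
    ((λ v → c v (K v) refl) , λ u v → proper u v (K u) (K v) refl refl)
    where
    y≢ : ∀ {v} → K v ≡ true → y ≢ v
    y≢ Kv refl = case trans (sym Kv) Ky of λ ()

    x≢ : ∀ {v} → K v ≡ false → x ≢ v
    x≢ Kv refl = case trans (sym Kv) Kx of λ ()

    c : ∀ v b → K v ≡ b → Fin k
    c v true Kv = proj₁ (colour y) (punchOut (y≢ Kv))
    c v false Kv = proj₁ (colour x) (punchOut (x≢ Kv))

    proper : ∀ u v b b′ (Ku : K u ≡ b) (Kv : K v ≡ b′) → u ~ v → c u b Ku ≢ c v b′ Kv
    proper u v true true Ku Kv uv = proj₂ (colour y) _ _
      (trans (cong₂ (adj G) (punchIn-punchOut (y≢ Ku)) (punchIn-punchOut (y≢ Kv))) uv)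
    proper u v false false Ku Kv uv = proj₂ (colour x) _ _
      (trans (cong₂ (adj G) (punchIn-punchOut (x≢ Ku)) (punchIn-punchOut (x≢ Kv))) uv)
    proper u v true false Ku Kv uv = ⊥-elim (excl (~-sym uv) (across v u Kv Ku))
    proper u v false true Ku Kv uv = ⊥-elim (excl uv (across u v Ku Kv))

  -- By `no-cut` some outside `z` sees a vertex of the module, hence all of it, so gem-freeness
  -- makes the module P₄-free. Its map into the clique `Q`, extended by the identity, is an
  -- endomorphism of G; by `no-folding` it misses no vertex, so `a` and `b` lie in `Q`.
  module-clique : (K : Vertex → Bool) → ∀ {a b w} → a ≢ b → K a ≡ true → K b ≡ true → K w ≡ false →
    (∀ u p q → K u ≡ false → K p ≡ true → K q ≡ true → adj G u p ≡ adj G u q) → a ~ b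
  module-clique K {a} {b} {w} a≢b Ka Kb Kw uniform
    with any? (λ z → (K z Bool.≟ false) ×-dec (adj G z a Bool.≟ true))
  ... | no isolated = ⊥-elim (no-cut K a w Ka Kw λ u v Ku Kv →
          trans (uniform u v a Ku Kv Ka) (¬~⇒≁ (λ ua → isolated (u , Ku , ua))))
  ... | yes (z , Kz , za) = folded
    where
    open Neighbourhood no-gem z

    in-K? : ∀ v → Dec (K v ≡ true)
    in-K? v = K v Bool.≟ true

    X = filter in-K? (allFin (suc n))

    K⇒X : ∀ {v} → K v ≡ true → v ∈ X
    K⇒X = ∈-filter⁺ in-K? (∈-allFin _)

    X⇒K : ∀ {v} → v ∈ X → K v ≡ true
    X⇒K v∈ = proj₂ (∈-filter⁻ in-K? {xs = allFin (suc n)} v∈)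

    open Shrink (shrink (length X) X ℕ.≤-refl (Unique-filter⁺ in-K? (allFin⁺ (suc n)))
      (λ v∈ → trans (uniform z _ a Kz (X⇒K v∈) Ka) za))

    f : Vertex → Vertex
    f v = if K v then retract v else v

    f-hom : ∀ {u v} → u ~ v → f u ~ f v
    f-hom {u} {v} uv with K u in Ku | K v in Kv
    ... | true | true = hom (K⇒X Ku) (K⇒X Kv) uv
    ... | false | false = uv
    ... | true | false = ~-sym (trans (uniform v _ u Kv (X⇒K (Q⊆ (into (K⇒X Ku)))) Ku) (~-sym uv))
    ... | false | true = trans (uniform u _ v Ku (X⇒K (Q⊆ (into (K⇒X Kv)))) Kv) uv

    image : ∀ {c v} → K c ≡ true → c ≡ f v → c ∈ Q
    image {c} {v} Kc eq with K v in Kv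
    ... | true = subst (_∈ Q) (sym eq) (into (K⇒X Kv))
    ... | false = case trans (sym Kc) (trans (cong K eq) Kv) of λ ()

    folded : a ~ b
    folded with any? (λ v → a Fin.≟ f v) | any? (λ v → b Fin.≟ f v)
    ... | no a-missed | _ = ⊥-elim (no-folding f f-hom a (λ v eq → a-missed (v , eq)))
    ... | _ | no b-missed = ⊥-elim (no-folding f f-hom b (λ v eq → b-missed (v , eq)))
    ... | yes (_ , a≡) | yes (_ , b≡) = Clique-lookup clique (image Ka a≡) (image Kb b≡) a≢b

  -- Adding `v` to `Q` gives a clique, so `Q` has at most `m` vertices and `v` at most 2m
  -- neighbours, one fewer than there are colours.
  claws : ∀ v → ¬ (∀ a b c → v ~ a → v ~ b → v ~ c → a ≢ b → a ≢ c → b ≢ c →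
    a ≁ b → a ≁ c → b ≁ c → ⊥)
  claws v no-claw = uncolourable (c (proj₁ fresh) , proper)
    where
    open Neighbourhood no-gem v

    nbr? : ∀ u → Dec (v ~ u)
    nbr? u = adj G v u Bool.≟ true

    X = filter nbr? (allFin (suc n))

    X⇒~ : ∀ {u} → u ∈ X → v ~ u
    X⇒~ u∈ = proj₂ (∈-filter⁻ nbr? {xs = allFin (suc n)} u∈)

    open Shrink (shrink (length X) X ℕ.≤-refl (Unique-filter⁺ nbr? (allFin⁺ (suc n))) X⇒~)

    no-triple : ¬ Triple X
    no-triple (a , b , c , (a∈ , b∈ , c∈) , (a≢b , a≢c , b≢c) , (ab , ac , bc)) =
      no-claw a b c (X⇒~ a∈) (X⇒~ b∈) (X⇒~ c∈) a≢b a≢c b≢c ab ac bc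

    Q≤ : length Q ≤ m
    Q≤ = s≤s⁻¹ (clique≤ _ (Clique⇒HasClique (tabulate (X⇒~ ∘ Q⊆) ∷ clique)))

    X<k : length X < k
    X<k = begin-strict
      length X ≤⟨ bound no-triple ⟩
      2 * length Q ≤⟨ ℕ.*-monoʳ-≤ 2 Q≤ ⟩
      2 * m <⟨ ℕ.≤-refl ⟩
      suc (2 * m) ≡⟨ ℕ.+-suc m (m + 0) ⟨
      k ∎
      where open ℕ.≤-Reasoning

    c : Fin k → Vertex → Fin k
    c i u with v Fin.≟ u
    ... | yes _ = i
    ... | no v≢u = proj₁ (colour v) (punchOut v≢u)

    -- A dummy colour for `v`; as `v` is not in `X`, it does not affect the colours seen there.
    i₀ : Fin k
    i₀ = Fin.fromℕ< (ℕ.≤-<-trans z≤n X<k)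

    fresh = unused (map (c i₀) X) (subst (_< k) (sym (length-map (c i₀) X)) X<k)

    unused-near : ∀ {u} → v ~ u → ∀ v≢u → proj₁ fresh ≢ proj₁ (colour v) (punchOut v≢u)
    unused-near {u} vu v≢u eq = proj₂ fresh (subst (_∈ map (c i₀) X) (sym (trans eq same))
      (∈-map⁺ (c i₀) (∈-filter⁺ nbr? (∈-allFin u) vu)))
      where
      same : proj₁ (colour v) (punchOut v≢u) ≡ c i₀ u
      same with v Fin.≟ u
      ... | yes v≡u = contradiction v≡u v≢u
      ... | no _ = cong (proj₁ (colour v)) (Fin.punchOut-cong v refl)

    proper : ∀ u w → u ~ w → c (proj₁ fresh) u ≢ c (proj₁ fresh) w
    proper u w uw with v Fin.≟ u | v Fin.≟ w
    ... | yes refl | yes refl = ⊥-elim (excl uw (irrefl G v))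
    ... | yes refl | no v≢w = unused-near uw v≢w
    ... | no v≢u | yes refl = unused-near (~-sym uw) v≢u ∘ sym
    ... | no v≢u | no v≢w = proj₂ (colour v) _ _
      (trans (cong₂ (adj G) (punchIn-punchOut v≢u) (punchIn-punchOut v≢w)) uw)

  closed : Vertex → Vertex → Bool
  closed x u = does (x Fin.≟ u) ∨ adj G x u

  Twin : Vertex → Vertex → Set
  Twin x y = ∀ u → closed x u ≡ closed y u

  closed-refl : ∀ x → closed x x ≡ true
  closed-refl x rewrite dec-true (x Fin.≟ x) refl = refl

  ~⇒closed : ∀ {x y} → x ~ y → closed x y ≡ true
  ~⇒closed {x} {y} xy rewrite xy = Bool.∨-zeroʳ _

  closed⇒~ : ∀ {x y} → x ≢ y → closed x y ≡ true → x ~ y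
  closed⇒~ {x} {y} x≢y cl rewrite dec-false (x Fin.≟ y) x≢y = cl

  Twin⇒~ : ∀ {x y} → Twin x y → x ≢ y → x ~ y
  Twin⇒~ {x} {y} tw x≢y = closed⇒~ x≢y (trans (tw y) (closed-refl y))

  Twin-transfer : ∀ {x a y} → Twin x a → a ≢ y → x ~ y → a ~ y
  Twin-transfer {y = y} tw a≢y xy = closed⇒~ a≢y (trans (sym (tw y)) (~⇒closed xy))

  abstract
    twin? : ∀ x y → Dec (Twin x y)
    twin? x y = all? λ u → closed x u Bool.≟ closed y u

    rep : Vertex → Vertex
    -- The default is never reached, as `x` is its own twin, so the result depends only on the twin
    -- class.
    rep x = pick-first (λ y → does (twin? x y)) (allFin (suc n)) x

    rep-twin : ∀ x → Twin x (rep x)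
    rep-twin x = does⇒ (twin? x (rep x))
      (pick-first-true (λ y → does (twin? x y)) (allFin (suc n)) (dec-true (twin? x x) λ _ → refl))

    rep-cong : ∀ {x y} → Twin x y → rep x ≡ rep y
    rep-cong {x} {y} tw = pick-first-cong same (∈-allFin x) (dec-true (twin? x x) λ _ → refl)
      where
      same : ∀ z → does (twin? x z) ≡ does (twin? y z)
      same z = does-⇔ (mk⇔ (λ xz u → trans (sym (tw u)) (xz u)) (λ yz u → trans (tw u) (yz u)))
        (twin? x z) (twin? y z)

  rep-idem : ∀ x → rep (rep x) ≡ rep x
  rep-idem x = sym (rep-cong (rep-twin x))

  rep≡⇒Twin : ∀ {x y} → rep x ≡ rep y → Twin x y
  rep≡⇒Twin {x} {y} eq u =
    trans (rep-twin x u) (trans (cong (λ r → closed r u) eq) (sym (rep-twin y u)))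

  rep-~ : ∀ {x y} → rep x ≢ rep y → x ~ y → rep x ~ rep y
  rep-~ {x} {y} r≢ xy = ~-sym (Twin-transfer (rep-twin y) (r≢ ∘ sym)
    (~-sym (Twin-transfer (rep-twin x) (λ { refl → r≢ (sym (rep-idem x)) }) xy)))

  open Decidable⇒UIP (Fin._≟_ {suc n}) using () renaming (≡-irrelevant to Vertex-irrelevant)

  Representative : Set
  Representative = Σ Vertex λ x → rep x ≡ x

  ⟦_⟧ : Vertex → Representative
  ⟦ x ⟧ = rep x , rep-idem x

  rep-≡ : {p q : Representative} → proj₁ p ≡ proj₁ q → p ≡ q
  rep-≡ {x , p} {_ , q} refl = cong (x ,_) (Vertex-irrelevant p q)

  ⟦⟧-fixed : ∀ p → ⟦ proj₁ p ⟧ ≡ p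
  ⟦⟧-fixed (x , p) = rep-≡ p

  deciding : ∀ (P : Representative → Set) → ((∀ p → Dec (P p)) → ⊥) → ⊥
  deciding P k = ¬¬-finite pointwise λ dec → k λ { (x , p) → dec x p }
    where
    pointwise : ∀ x → ¬ ¬ (∀ p → Dec (P (x , p)))
    pointwise x k′ with rep x Fin.≟ x
    ... | no ¬p = k′ λ p → contradiction p ¬p
    ... | yes p = k′ λ q → no λ Pq → k′ λ q′ → yes (subst (λ r → P (x , r)) (Vertex-irrelevant q q′) Pq)

  quotient : PrimeClawGraph
  quotient = record
    { V = Representative
    ; _≟ᵥ_ = λ p q → map′ rep-≡ (cong proj₁) (proj₁ p Fin.≟ proj₁ q)
    ; E = λ p q → adj G (proj₁ p) (proj₁ q)
    ; E-sym = λ p q → Graph.sym G (proj₁ p) (proj₁ q)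
    ; E-irrefl = λ p → irrefl G (proj₁ p)
    ; claw = quotient-claw
    ; prime = quotient-prime
    ; deciding = deciding
    }
    where
    -- Non-adjacent leaves are not twins, and no leaf is a twin of `v`, which sees the other leaves;
    -- so a claw survives the passage to representatives.
    quotient-claw : ∀ v → ¬ (∀ a b c → proj₁ v ~ proj₁ a → proj₁ v ~ proj₁ b → proj₁ v ~ proj₁ c →
      a ≢ b → a ≢ c → b ≢ c → proj₁ a ≁ proj₁ b → proj₁ a ≁ proj₁ c → proj₁ b ≁ proj₁ c → ⊥)
    quotient-claw (v , v-rep) none = claws v λ a b c va vb vc a≢b a≢c b≢c ab ac bc →
      none ⟦ a ⟧ ⟦ b ⟧ ⟦ c ⟧
        (joined va vb a≢b ab) (joined vb va (a≢b ∘ sym) (≁-sym ab)) (joined vc va (a≢c ∘ sym) (≁-sym ac))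
        (distinct a≢b ab ∘ cong proj₁) (distinct a≢c ac ∘ cong proj₁) (distinct b≢c bc ∘ cong proj₁)
        (separate a≢b ab) (separate a≢c ac) (separate b≢c bc)
      where
      distinct : ∀ {a b} → a ≢ b → a ≁ b → rep a ≢ rep b
      distinct a≢b ab eq = excl (Twin⇒~ (rep≡⇒Twin eq) a≢b) ab

      joined : ∀ {a b} → v ~ a → v ~ b → a ≢ b → a ≁ b → v ~ rep a
      joined {a} {b} va vb a≢b ab = ~-sym (Twin-transfer (rep-twin a) ra≢v (~-sym va))
        where
        ra≢v : rep a ≢ v
        ra≢v refl = excl (Twin-transfer (λ u → sym (rep-twin a u)) a≢b vb) ab

      separate : ∀ {a b} → a ≢ b → a ≁ b → rep a ≁ rep b
      separate {a} {b} a≢b ab = ¬~⇒≁ λ rr →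
        excl (~-sym (Twin-transfer (λ u → sym (rep-twin b u)) (a≢b ∘ sym)
          (~-sym (Twin-transfer (λ u → sym (rep-twin a u)) a≢rb rr)))) ab
        where
        a≢rb : a ≢ rep b
        a≢rb refl = distinct a≢b ab (rep-idem b)

    -- The preimage of `K` is a module of G, hence a clique; the vertices of a clique module are
    -- true twins and share a representative.
    quotient-prime : ∀ (K : Representative → Bool) x y z → x ≢ y → K x ≡ true → K y ≡ true →
      K z ≡ false → ¬ (∀ u a b → K u ≡ false → K a ≡ true → K b ≡ true →
        adj G (proj₁ u) (proj₁ a) ≡ adj G (proj₁ u) (proj₁ b))
    quotient-prime K x y z x≢y Kx Ky Kz uniform = x≢y (rep-≡ (trans (sym (proj₂ x))
      (trans (rep-cong twins) (proj₂ y))))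
      where
      K̃ : Vertex → Bool
      K̃ v = K ⟦ v ⟧

      lift : ∀ {p b} → K p ≡ b → K̃ (proj₁ p) ≡ b
      lift {p} Kp = trans (cong K (⟦⟧-fixed p)) Kp

      outer : ∀ u a → K̃ u ≡ false → K̃ a ≡ true → adj G u a ≡ adj G (rep u) (rep a)
      outer u a Ku Ka with rep u Fin.≟ rep a
      ... | yes eq = case trans (sym Ku) (trans (cong K (rep-≡ eq)) Ka) of λ ()
      ... | no r≢ with ~? u a | ~? (rep u) (rep a)
      ...   | inj₁ ua | _ = trans ua (sym (rep-~ r≢ ua))
      ...   | inj₂ ua | inj₂ rr = trans ua (sym rr)
      ...   | inj₂ ua | inj₁ rr = ⊥-elim (excl
        (~-sym (Twin-transfer (λ w → sym (rep-twin a w)) (λ { refl → r≢ refl })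
          (~-sym (Twin-transfer (λ w → sym (rep-twin u w)) (λ { refl → r≢ (rep-idem a) }) rr)))) ua)

      K̃-uniform : ∀ u a b → K̃ u ≡ false → K̃ a ≡ true → K̃ b ≡ true → adj G u a ≡ adj G u b
      K̃-uniform u a b Ku Ka Kb =
        trans (outer u a Ku Ka) (trans (uniform ⟦ u ⟧ ⟦ a ⟧ ⟦ b ⟧ Ku Ka Kb) (sym (outer u b Ku Kb)))

      inner : ∀ {a b} → K̃ a ≡ true → K̃ b ≡ true → closed a b ≡ true
      inner {a} {b} Ka Kb with a Fin.≟ b
      ... | yes refl = refl
      ... | no a≢b = module-clique K̃ a≢b Ka Kb (lift {z} Kz) K̃-uniform

      twins : Twin (proj₁ x) (proj₁ y)
      twins u with K̃ u in Ku
      ... | true = trans (inner (lift {x} Kx) Ku) (sym (inner (lift {y} Ky) Ku))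
      ... | false = trans (outside (lift {x} Kx)) (trans
          (K̃-uniform u _ _ Ku (lift {x} Kx) (lift {y} Ky)) (sym (outside (lift {y} Ky))))
        where
        outside : ∀ {a} → K̃ a ≡ true → closed a u ≡ adj G u a
        outside {a} Ka rewrite dec-false (a Fin.≟ u) (λ { refl → case trans (sym Ka) Ku of λ () }) =
          Graph.sym G a u

-- Colouring a bipartite graph blown up to cliques

module CriticalColouring {n : ℕ} (G : Graph (suc n)) (m : ℕ)
  (uncolourable : ¬ χ≤ G (2 * suc m ∸ 1)) (colour : ∀ x → χ≤ (delete G x) (2 * suc m ∸ 1))
  (clique≤ : ∀ j → HasClique G j → j ≤ suc m)
  (no-chair : OnGraph.Avoids G chairʳ) (no-gem : OnGraph.Avoids G gemʳ) where
  open OnGraph G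
  open Critical G m uncolourable colour clique≤ no-chair no-gem

  class? : ∀ x y → Dec (y Fin.< x × rep y ≡ rep x)
  class? x y = (y Fin.<? x) ×-dec (rep y Fin.≟ rep x)

  earlier : Vertex → List Vertex
  earlier x = filter (class? x) (allFin (suc n))

  ∈-earlier : ∀ {x y} → y ∈ earlier x → y Fin.< x × rep y ≡ rep x
  ∈-earlier {x} y∈ = proj₂ (∈-filter⁻ (class? x) {xs = allFin (suc n)} y∈)

  upto : Vertex → List Vertex
  upto x = x ∷ earlier x

  upto-rep : ∀ {x y} → y ∈ upto x → rep y ≡ rep x
  upto-rep (here refl) = refl
  upto-rep (there y∈) = proj₂ (∈-earlier y∈)

  upto-unique : ∀ x → Unique (upto x)
  upto-unique x = tabulate (λ { y∈ refl → Fin.<-irrefl refl (proj₁ (∈-earlier y∈)) })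
    ∷ Unique-filter⁺ (class? x) (allFin⁺ (suc n))

  rank : Vertex → ℕ
  rank x = length (earlier x)

  rank-< : ∀ {x y} → x Fin.< y → rep x ≡ rep y → rank x < rank y
  rank-< {x} {y} x<y eq = Unique-⊆-length (upto-unique x) λ where
    (here refl) → ∈-filter⁺ (class? y) (∈-allFin x) (x<y , eq)
    (there z∈) → ∈-filter⁺ (class? y) (∈-allFin _)
      (Fin.<-trans (proj₁ (∈-earlier z∈)) x<y , trans (proj₂ (∈-earlier z∈)) eq)

  same-class : ∀ {a b} → rep a ≡ rep b → a ≢ b → a ~ b
  same-class = Twin⇒~ ∘ rep≡⇒Twin

  rank≤ : ∀ x → rank x ≤ m
  rank≤ x = s≤s⁻¹ (clique≤ _ (Clique⇒HasClique (Clique-intro (upto-unique x)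
    λ a∈ b∈ → same-class (trans (upto-rep a∈) (sym (upto-rep b∈))))))

  -- The initial segments of the two classes, with rank x + 1 and rank y + 1 vertices, together form
  -- a clique of at most m + 1 vertices.
  rank-sum : ∀ {x y} → x ~ y → rep x ≢ rep y → rank x + rank y < m
  rank-sum {x} {y} xy r≢ = s≤s⁻¹ (begin
    suc (suc (rank x + rank y)) ≡⟨ cong suc (ℕ.+-suc (rank x) (rank y)) ⟨
    length (upto x) + length (upto y) ≡⟨ length-++ (upto x) ⟨
    length (upto x ++ upto y) ≤⟨ clique≤ _ (Clique⇒HasClique (Clique-intro unique adjacent)) ⟩
    suc m ∎)
    where
    open ℕ.≤-Reasoning

    across : ∀ {a b} → a ∈ upto x → b ∈ upto y → a ~ b
    across {a} {b} a∈ b∈ =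
      ~-sym (Twin-transfer (λ u → sym (rep≡⇒Twin (upto-rep b∈) u)) b≢a
        (~-sym (Twin-transfer (λ u → sym (rep≡⇒Twin (upto-rep a∈) u)) a≢y xy)))
      where
      a≢y : a ≢ y
      a≢y refl = r≢ (sym (upto-rep a∈))
      b≢a : b ≢ a
      b≢a refl = r≢ (trans (sym (upto-rep a∈)) (upto-rep b∈))

    unique : Unique (upto x ++ upto y)
    unique = Unique-++⁺ (upto-unique x) (upto-unique y)
      λ (a∈ , a∈′) → r≢ (trans (sym (upto-rep a∈)) (upto-rep a∈′))

    adjacent : ∀ {a b} → a ∈ upto x ++ upto y → b ∈ upto x ++ upto y → a ≢ b → a ~ b
    adjacent a∈ b∈ a≢b with ∈-++⁻ (upto x) a∈ | ∈-++⁻ (upto x) b∈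
    ... | inj₁ a∈x | inj₁ b∈x = same-class (trans (upto-rep a∈x) (sym (upto-rep b∈x))) a≢b
    ... | inj₂ a∈y | inj₂ b∈y = same-class (trans (upto-rep a∈y) (sym (upto-rep b∈y))) a≢b
    ... | inj₁ a∈x | inj₂ b∈y = across a∈x b∈y
    ... | inj₂ a∈y | inj₁ b∈x = ~-sym (across b∈x a∈y)

  -- On one side the twin classes are coloured upwards from 0, on the other
  -- downwards from m; two adjacent classes form a clique, so they do not overlap.
  no-bipartition : (side : Representative → Bool) →
    (∀ x y → proj₁ x ~ proj₁ y → side x ≢ side y) → ⊥
  no-bipartition side proper = uncolourable
    ( (λ x → Fin.fromℕ< (ℕ.≤-<-trans (shade≤ (side ⟦ x ⟧) x) m<k))
    , λ x y xy eq → clash xy (Fin.fromℕ<-injective _ _ _ _ eq))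
    where
    shade : Bool → Vertex → ℕ
    shade true x = rank x
    shade false x = m ∸ rank x

    shade≤ : ∀ b x → shade b x ≤ m
    shade≤ true x = rank≤ x
    shade≤ false x = ℕ.m∸n≤m m (rank x)

    m<k : m < k
    m<k = ℕ.m<m+n m (s≤s z≤n)

    opposed : ∀ {x y} → x ~ y → rep x ≢ rep y → rank x ≢ m ∸ rank y
    opposed {x} {y} xy r≢ eq = ℕ.<-irrefl (trans (cong (_+ rank y) eq) (ℕ.m∸n+n≡m (rank≤ y))) (rank-sum xy r≢)

    rank-≢ : ∀ {x y} → x ≢ y → rep x ≡ rep y → rank x ≢ rank y
    rank-≢ {x} {y} x≢y r≡ eq with Fin.<-cmp x y
    ... | tri< x<y _ _ = ℕ.<-irrefl eq (rank-< x<y r≡)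
    ... | tri≈ _ x≡y _ = x≢y x≡y
    ... | tri> _ _ y<x = ℕ.<-irrefl (sym eq) (rank-< y<x (sym r≡))

    clash : ∀ {x y} → x ~ y → shade (side ⟦ x ⟧) x ≢ shade (side ⟦ y ⟧) y
    clash {x} {y} xy eq with rep x Fin.≟ rep y
    ... | yes r≡ with side ⟦ x ⟧ | side ⟦ y ⟧ | cong side (rep-≡ {⟦ x ⟧} {⟦ y ⟧} r≡)
    ...   | true | true | _ = rank-≢ (~⇒≢ xy) r≡ eq
    ...   | false | false | _ = rank-≢ (~⇒≢ xy) r≡ (ℕ.∸-cancelˡ-≡ (rank≤ x) (rank≤ y) eq)
    clash {x} {y} xy eq | no r≢ with side ⟦ x ⟧ | side ⟦ y ⟧ | proper ⟦ x ⟧ ⟦ y ⟧ (rep-~ r≢ xy)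
    ...   | true | false | _ = opposed xy r≢ eq
    ...   | false | true | _ = opposed (~-sym xy) (r≢ ∘ sym) (sym eq)
    ...   | true | true | s≢ = s≢ refl
    ...   | false | false | s≢ = s≢ refl

  contradictory : ⊥
  contradictory = bipartition ⟦ zero ⟧ no-bipartition
    where
    open PrimeClawGraph quotient using (E; E-sym; E-irrefl)
    open Listing E E-sym E-irrefl using () renaming (rows to rowsᵣ; Avoids to Avoidsᵣ)

    rows-map : ∀ xs → rowsᵣ xs ≡ rows (map proj₁ xs)
    rows-map [] = refl
    rows-map (x ∷ xs) = cong₂ _∷_ (map-∘ xs) (rows-map xs)

    Avoids⇒Avoidsᵣ : ∀ {S} → Avoids S → Avoidsᵣ S
    Avoids⇒Avoidsᵣ avoids xs u eq =
      avoids (map proj₁ xs) (Unique-map⁺ rep-≡ u) (trans (sym (rows-map xs)) eq)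

    open Bipartition quotient (Avoids⇒Avoidsᵣ no-chair) (Avoids⇒Avoidsᵣ no-gem)

-- Induction on the number of vertices

-- Deleting a vertex may lower ω, so the induction keeps `m` fixed and carries only an upper bound
-- on cliques.
colouring : ∀ {n} (G : Graph n) m → G Free chair → G Free gem →
  (∀ j → HasClique G j → j ≤ suc m) → χ≤ G (2 * suc m ∸ 1)
colouring {zero} G m _ _ _ = (λ ()) , λ ()
colouring {suc n} G m no-chair no-gem clique≤ with colourable? {2 * suc m ∸ 1} G
... | yes c = c
... | no uncolourable = ⊥-elim (CriticalColouring.contradictory G m uncolourable
    (λ x → colouring (delete G x) m (delete-Free G x no-chair) (delete-Free G x no-gem)
      (λ j → clique≤ j ∘ delete-HasClique G x))
    clique≤
    (OnGraph.Free⇒Avoids G chair chairʳ refl no-chair (from-yes (matches? chairʳ chair)))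
    (OnGraph.Free⇒Avoids G gem gemʳ refl no-gem (from-yes (matches? gemʳ gem))))

theorem1 : ∀ {n} (G : Graph n) (ω : ℕ) →
    G Free chair → G Free gem → IsCliqueNumber G ω →
    χ≤ G (2 * ω ∸ 1)
theorem1 {zero} G ω _ _ _ = (λ ()) , λ ()
-- For ω = 0 truncated subtraction leaves no colours, but a single vertex is already a clique.
theorem1 {suc n} G zero _ _ (_ , clique≤) =
  case clique≤ 1 ((λ _ → zero) , (λ { {zero} {zero} _ → refl }) , λ { zero zero i≢i → contradiction refl i≢i }) of λ ()
theorem1 {suc n} G (suc m) no-chair no-gem (_ , clique≤) = colouring G m no-chair no-gem clique≤
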